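{- Let $s,t\ge 1$ and $D\ge 3$, and let $\ell=2\lceil\log s/\log(D-1)\rceil+3$. Let $\mathcal{G}=\{G_1,\dots,G_t\}$ be an $s$-joined graph family on $n$ vertices. Let $\mathcal{H}$ be a $[t]$-edge-colored expansion of $K_D$ such that each path of $\mathcal{H}$ has length at least $\ell$ and $\Delta^{mon}(\mathcal{H})\le D$. If $|V(\mathcal{H})|\le n-6sD$, then $\mathcal{G}$ contains $\mathcal{H}$.
   Context: $\mathcal{G}=\{G_1,\dots,G_t\}$ is a family of graphs on a common vertex set $V$ with $|V|=n$. Its auxiliary bipartite graph $B_{\mathcal G}$ has parts $V\times[t]$ and $V$, with $(u,i)$ adjacent to $v$ iff $uv\in E(G_i)$; the family is $s$-joined if for all $X\subseteq V\times[t]$, $Y\subseteq V$ with $|X|,|Y|\ge s$ there is an edge of $B_{\mathcal G}$ between $X$ and $Y$. A $[t]$-edge-colored graph is a simple graph with edges colored from $[t]$; $d_i(v)$ is the number of color-$i$ edges at $v$ and $\Delta^{mon}(\mathcal H)=\max_i\max_v d_i(v)$. A graph $H'$ is an expansion of a graph $H$ if $V(H')$ is the union of sets $T_x$ ($x\in V(H)$) and $P_{yz}$ ($yz\in E(H)$) such that: each $H'[T_x]$ is a tree (a branch); each $H'[P_{yz}]$ is a path (a path of $H'$); the sets $T_x,P_{yz}$ are pairwise disjoint except possibly at end vertices of the paths; $P_{yz}\cap T_x=\emptyset$ if $x\notin\{y,z\}$; one end vertex of $P_{yz}$ lies in $T_y$ and the other in $T_z$. $\mathcal{G}$ contains $\mathcal{H}$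 if there is an injective $\phi:V(\mathcal H)\to V$ with $\phi(u)\phi(v)\in E(G_i)$ for every edge $uv$ of color $i$.
   Formalization: An expansion is additionally required to have every edge inside one of its branches or paths (the stated definition constrains only its vertex set, and extra edges, e.g. a triangle between branches, would make the claim false); branches are read as pairwise disjoint. -}

module Defs where

open import Data.Nat using (ℕ; zero; suc; _+_; _*_; _∸_; _^_; _≤_)
open import Data.Fin using (Fin; toℕ) renaming (_<_ to _<ᶠ_)
open import Data.Fin.Subset using (Subset) renaming (_∈_ to _∈ₛ_)
open import Data.Fin.Properties using () renaming (_≟_ to _≟ᶠ_)
open import Data.Maybe using (Maybe; just; nothing)
open import Data.Maybe.Properties using (≡-dec)
open import Data.List using (List; []; _∷_; length; head; last; filter; allFin; lookup)
open import Data.List.Membership.Propositional using () renaming (_∈_ to _∈ₗ_)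
open import Data.List.Relation.Unary.All using (All)
open import Data.List.Relation.Unary.Linked using (Linked)
open import Data.List.Relation.Unary.Unique.Propositional using (Unique)
open import Data.Product using (Σ; ∃; ∃₂; _×_; _,_)
open import Data.Sum using (_⊎_)
open import Data.Empty using (⊥)
open import Relation.Nullary using (¬_)
open import Relation.Binary.PropositionalEquality using (_≡_; _≢_)
open import Function.Definitions using (Injective)

-- k = ⌈ log s / log b ⌉ (for s ≥ 1, b ≥ 2): the least natural k with s ≤ b ^ k
IsCeilLog : ℕ → ℕ → ℕ → Set
IsCeilLog b s k = (s ≤ b ^ k) × (∀ j → s ≤ b ^ j → k ≤ j)

record Graph (n : ℕ) : Set₁ where
  field
    Adj   : Fin n → Fin n → Set
    sym   : ∀ {u v} → Adj u v → Adj v u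
    irrefl : ∀ {u} → ¬ Adj u u

-- graph family G_1..G_t on V = Fin n is s-joined:
-- finite subsets are represented as duplicate-free lists
SJoined : {n t : ℕ} → ℕ → (Fin t → Graph n) → Set
SJoined {n} {t} s 𝒢 =
  ∀ (X : List (Fin n × Fin t)) (Y : List (Fin n)) →
  Unique X → Unique Y → s ≤ length X → s ≤ length Y →
  ∃₂ λ (u : Fin n) (i : Fin t) → ∃ λ (v : Fin n) →
    ((u , i) ∈ₗ X) × (v ∈ₗ Y) × Graph.Adj (𝒢 i) u v

-- a [t]-edge-coloured simple graph on vertex set Fin m:
-- col x y = just i  iff  xy is an edge of colour i
record ColGraph (m t : ℕ) : Set where
  field
    col    : Fin m → Fin m → Maybe (Fin t)
    sym    : ∀ x y → col x y ≡ col y x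
    irrefl : ∀ x → col x x ≡ nothing

module _ {m t : ℕ} (H : ColGraph m t) where
  open ColGraph H

  HAdj : Fin m → Fin m → Set
  HAdj x y = Σ (Fin t) λ i → col x y ≡ just i

  dmon : Fin t → Fin m → ℕ
  dmon i v = length (filter (λ w → ≡-dec _≟ᶠ_ (col v w) (just i)) (allFin m))

  MonDegAtMost : ℕ → Set
  MonDegAtMost D = ∀ i v → dmon i v ≤ D

  Walk : Subset m → Fin m → Fin m → Set
  Walk S u v = ∃ λ (ws : List (Fin m)) →
    All (_∈ₛ S) (u ∷ ws) × Linked HAdj (u ∷ ws) × (last (u ∷ ws) ≡ just v)

  Cycle : Subset m → Set
  Cycle S = ∃₂ λ (x y : Fin m) → ∃ λ (ws : List (Fin m)) →
    (2 ≤ length ws) × Unique (x ∷ ws) × All (_∈ₛ S) (x ∷ ws) ×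
    Linked HAdj (x ∷ ws) × (last (x ∷ ws) ≡ just y) × HAdj y x

  IsTree : Subset m → Set
  IsTree S = (∃ λ v → v ∈ₛ S) × (∀ u v → u ∈ₛ S → v ∈ₛ S → Walk S u v) × ¬ Cycle S

  IsInducedPath : List (Fin m) → Set
  IsInducedPath p = (1 ≤ length p) × Unique p × Linked HAdj p ×
    (∀ (a b : Fin (length p)) → HAdj (lookup p a) (lookup p b) →
      (toℕ a ≡ suc (toℕ b)) ⊎ (toℕ b ≡ suc (toℕ a)))

  IsEnd : List (Fin m) → Fin m → Set
  IsEnd p v = (head p ≡ just v) ⊎ (last p ≡ just v)

  record ExpansionOfK (D : ℕ) : Set where
    field
      T : Fin D → Subset m
      P : Fin D → Fin D → List (Fin m)
      T-tree : ∀ x → IsTree (T x)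
      P-path : ∀ y z → y <ᶠ z → IsInducedPath (P y z)
      P-ends : ∀ y z → y <ᶠ z → ∃₂ λ a b →
        (head (P y z) ≡ just a) × (last (P y z) ≡ just b) × (a ∈ₛ T y) × (b ∈ₛ T z)
      TT-disj : ∀ x x' → x ≢ x' → ∀ v → v ∈ₛ T x → v ∈ₛ T x' → ⊥
      TP-disj : ∀ y z → y <ᶠ z → ∀ x v → v ∈ₛ T x → v ∈ₗ P y z →
        ((x ≡ y) ⊎ (x ≡ z)) × IsEnd (P y z) v
      PP-disj : ∀ y z y' z' → y <ᶠ z → y' <ᶠ z' → (y ≢ y') ⊎ (z ≢ z') →
        ∀ v → v ∈ₗ P y z → v ∈ₗ P y' z' → IsEnd (P y z) v ⊎ IsEnd (P y' z') v
      cover : ∀ v → (∃ λ x → v ∈ₛ T x) ⊎ (∃₂ λ y z → (y <ᶠ z) × (v ∈ₗ P y z))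
      edges : ∀ u v → HAdj u v →
        (∃ λ x → (u ∈ₛ T x) × (v ∈ₛ T x)) ⊎
        (∃₂ λ y z → (y <ᶠ z) × (u ∈ₗ P y z) × (v ∈ₗ P y z))

Contains : {n m t : ℕ} → (Fin t → Graph n) → ColGraph m t → Set
Contains {n} {m} {t} 𝒢 H = ∃ λ (φ : Fin m → Fin n) → Injective _≡_ _≡_ φ ×
  (∀ x y i → ColGraph.col H x y ≡ just i → Graph.Adj (𝒢 i) (φ x) (φ y))

{-# OPTIONS --safe #-}
-- Work in the bipartite graph B of the family, with one extra left vertex joined to everything
-- that serves as common parent of the D branch roots.  A partial embedding is recorded by the
-- right vertices it uses and, for each, the left vertex (u , i) that owns it, i.e. whose
-- colour-i edge it was attached along.  The state is kept extendable: every set X of at most 2s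
-- left vertices has at least D |X| neighbours that are unused or owned by X.  As in the theorem
-- of Friedman and Pippenger, sets for which this is tight have fewer than s elements and are
-- closed under union, so a left vertex owning fewer than D vertices can always be given one
-- more.  Releasing vertices preserves extendability, whatever else is kept.
--
-- Branches are embedded vertex by vertex, and so is each path up to its last 2k + 3 edges.  From
-- the two ends of what is missing grow trees whose j-th level uses the colour of the j-th edge;
-- they branch D - 1 times at each level but the first and have (D - 1)^k ≥ s leaves.  Joinedness
-- gives the middle edge between two leaves, and all but the two tree paths are released.
--
-- To start, remove a maximal set Z of fewer than s left vertices with at most D |Z| neighbours
-- outside its own projection to V; avoiding that projection, the empty embedding is extendable.

module Submission where

open import Defs
open import Algebra.Properties.CommutativeSemigroup using (interchange)
open import Data.Empty using (⊥; ⊥-elim)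
open import Data.Fin using (Fin; zero; suc; toℕ; fromℕ<; combine; remQuot) renaming (_<_ to _<ᶠ_)
open import Data.Fin.Properties using (any?; all?; injective⇒≤; toℕ-fromℕ<; toℕ<n; remQuot-combine; combine-remQuot; combine-injectiveˡ; combine-injectiveʳ) renaming (_≟_ to _≟ᶠ_; _<?_ to _<ᶠ?_; suc-injective to suc-injectiveᶠ)
open import Data.Fin.Subset using (Subset; _∪_; _∩_; ⁅_⁆) renaming (_∈_ to _∈ₛ_; _∉_ to _∉ₛ_; ⊥ to ∅ₛ)
open import Data.Fin.Subset.Properties using (anySubset?; x∈p∪q⁺; x∈p∪q⁻; x∈p∩q⁺; x∈p∩q⁻; x∈⁅x⁆; x∈⁅y⁆⇒x≡y; ∉⊥; drop-there) renaming (_∈?_ to _∈ₛ?_)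
open import Data.List using (List; []; _∷_; _++_; _∷ʳ_; length; map; head; last; lookup; filter; allFin; cartesianProduct)
open import Data.List.Membership.Propositional using () renaming (_∈_ to _∈ₗ_; _∉_ to _∉ₗ_)
open import Data.List.Membership.Propositional.Properties using (∈-lookup; ∈-++⁺ˡ; ∈-++⁺ʳ; ∈-++⁻; ∈-map⁺; ∈-map⁻; ∈-filter⁺; ∈-filter⁻; ∈-cartesianProduct⁺; ∈-allFin)
open import Data.List.Membership.Setoid.Properties using (index-injective)
open import Data.List.Properties using (length-map; length-++; length-tabulate; filter-all; filter-none)
open import Data.List.Relation.Unary.All using (All; []; _∷_)
open import Data.List.Relation.Unary.AllPairs using ([]; _∷_)
open import Data.List.Relation.Unary.Any using (here; there; index)
open import Data.List.Relation.Unary.Any.Properties using (lookup-index)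
open import Data.List.Relation.Unary.Linked using (Linked; [-]; _∷_)
open import Data.List.Relation.Unary.Unique.Propositional using (Unique)
open import Data.Maybe using (just; nothing; fromMaybe)
open import Data.Maybe.Properties using (≡-dec; just-injective)
open import Data.Nat using (ℕ; zero; suc; _+_; _*_; _∸_; _^_; _≤_; _<_; z≤n; s≤s; _≤?_; _<?_)
open import Data.Nat.Properties
open import Data.Nat.Tactic.RingSolver using (solve-∀)
open import Data.Product using (Σ; ∃; ∃₂; _×_; _,_; proj₁; proj₂)
open import Data.Sum using (_⊎_; inj₁; inj₂; [_,_]′)
open import Data.Unit using (⊤; tt)
open import Data.Vec using (_∷_; there) renaming (tabulate to tabulateᵥ)
open import Data.Vec.Properties using (lookup∘tabulate; []=⇒lookup; lookup⇒[]=)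
open import Level using (0ℓ)
open import Relation.Binary.PropositionalEquality using (_≡_; _≢_; refl; sym; trans; cong; cong₂; subst; subst₂; setoid)
open import Relation.Nullary using (¬_; Dec; yes; no; does; contradiction; ¬?)
open import Relation.Nullary.Decidable using (_×-dec_; _⊎-dec_; _→-dec_; toSum; dec-true)
open import Relation.Unary using (Decidable; Pred; ∅; U)
open import Relation.Unary.Properties using (∅?; U?; _∪?_)
import Data.List.Relation.Unary.All as All
import Data.List.Relation.Unary.All.Properties as Allₚ
import Data.List.Relation.Unary.Unique.Propositional.Properties as Uniqueₚ

-- Counting in Fin n

lookup-injective : ∀ {A : Set} {xs : List A} → Unique xs →
  ∀ i j → lookup xs i ≡ lookup xs j → i ≡ j
lookup-injective (_ ∷ _)  zero    zero    _  = refl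
lookup-injective (x∉ ∷ _) zero    (suc j) eq = contradiction eq (All.lookup x∉ (∈-lookup j))
lookup-injective (x∉ ∷ _) (suc i) zero    eq = contradiction (sym eq) (All.lookup x∉ (∈-lookup i))
lookup-injective (_ ∷ u)  (suc i) (suc j) eq = cong suc (lookup-injective u i j eq)

-- Sending each position of `xs` to the position of its entry in `ys` is injective, by uniqueness of
-- `xs`.
unique-⊆⇒length≤ : ∀ {A : Set} {xs ys : List A} → Unique xs →
  (∀ {x} → x ∈ₗ xs → x ∈ₗ ys) → length xs ≤ length ys
unique-⊆⇒length≤ {A} {xs} u xs⊆ys = injective⇒≤ {f = λ i → index (xs⊆ys (∈-lookup {xs = xs} i))}
  λ {i} {j} eq → lookup-injective u i j (index-injective (setoid A) (xs⊆ys (∈-lookup i)) (xs⊆ys (∈-lookup j)) eq)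

module _ {n : ℕ} where

  # : {P : Pred (Fin n) 0ℓ} → Decidable P → ℕ
  # P? = length (filter P? (allFin n))

indicator : {A : Set} → Dec A → ℕ
indicator (yes _) = 1
indicator (no _)  = 0

length-filter-∷ : ∀ {A : Set} {P : Pred A 0ℓ} (P? : Decidable P) x xs →
  length (filter P? (x ∷ xs)) ≡ indicator (P? x) + length (filter P? xs)
length-filter-∷ P? x xs with P? x
... | yes p = refl
... | no ¬p = refl

indicator-exchange : ∀ {A B P Q : Set} (a : Dec A) (b : Dec B) (p : Dec P) (q : Dec Q) →
  (A → P ⊎ Q) → (B → P ⊎ Q) → (A → B → P × Q) →
  indicator a + indicator b ≤ indicator p + indicator q
indicator-exchange (no _)  (no _)  p q f g h = z≤n
indicator-exchange (yes a) (yes b) (no ¬p) q f g h = contradiction (proj₁ (h a b)) ¬p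
indicator-exchange (yes a) (yes b) (yes p) (no ¬q) f g h = contradiction (proj₂ (h a b)) ¬q
indicator-exchange (yes a) (yes b) (yes p) (yes q) f g h = ≤-refl
indicator-exchange (yes a) (no _) (yes p) q f g h = s≤s z≤n
indicator-exchange (yes a) (no _) (no ¬p) (yes q) f g h = ≤-refl
indicator-exchange (yes a) (no _) (no ¬p) (no ¬q) f g h with f a
... | inj₁ p = contradiction p ¬p
... | inj₂ q = contradiction q ¬q
indicator-exchange (no _) (yes b) (yes p) q f g h = s≤s z≤n
indicator-exchange (no _) (yes b) (no ¬p) (yes q) f g h = ≤-refl
indicator-exchange (no _) (yes b) (no ¬p) (no ¬q) f g h with g b
... | inj₁ p = contradiction p ¬p
... | inj₂ q = contradiction q ¬q

module _ {n : ℕ} {A B P Q : Pred (Fin n) 0ℓ}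
         (A? : Decidable A) (B? : Decidable B) (P? : Decidable P) (Q? : Decidable Q) where

  -- Pointwise comparison of indicators, summed over all indices. Union bounds, disjoint sums,
  -- monotonicity and submodularity below are all instances of it.
  #-exchange : (∀ {i} → A i → P i ⊎ Q i) → (∀ {i} → B i → P i ⊎ Q i) →
               (∀ {i} → A i → B i → P i × Q i) → # A? + # B? ≤ # P? + # Q?
  #-exchange f g h = go (allFin n)
    where
    go : ∀ xs → length (filter A? xs) + length (filter B? xs) ≤ length (filter P? xs) + length (filter Q? xs)
    go []       = z≤n
    go (x ∷ xs) = subst₂ _≤_ (regroup A? B?) (regroup P? Q?)
      (+-mono-≤ (indicator-exchange (A? x) (B? x) (P? x) (Q? x) f g h) (go xs))
      where
      regroup : ∀ {S T : Pred (Fin n) 0ℓ} (S? : Decidable S) (T? : Decidable T) →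
        indicator (S? x) + indicator (T? x) + (length (filter S? xs) + length (filter T? xs)) ≡
        length (filter S? (x ∷ xs)) + length (filter T? (x ∷ xs))
      regroup S? T? = trans
        (interchange +-commutativeSemigroup (indicator (S? x)) (indicator (T? x)) (length (filter S? xs)) (length (filter T? xs)))
        (sym (cong₂ _+_ (length-filter-∷ S? x xs) (length-filter-∷ T? x xs)))

module _ {n : ℕ} where

  #-∅ : # {n} {∅} ∅? ≡ 0
  #-∅ = cong length (filter-none ∅? {xs = allFin n} (All.tabulate λ _ ()))

  #-U : # {n} {U} U? ≡ n
  #-U = trans (cong length (filter-all U? {xs = allFin n} (All.tabulate λ _ → tt))) (length-tabulate _)

module _ {n : ℕ} {A P Q : Pred (Fin n) 0ℓ}
         (A? : Decidable A) (P? : Decidable P) (Q? : Decidable Q) where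

  #-cover : (∀ {i} → A i → P i ⊎ Q i) → # A? ≤ # P? + # Q?
  #-cover f = ≤-trans (m≤m+n _ _) (#-exchange A? ∅? P? Q? f (λ ()) (λ _ ()))

  #-disjoint : (∀ {i} → P i → A i) → (∀ {i} → Q i → A i) → (∀ {i} → P i → Q i → ⊥) → # P? + # Q? ≤ # A?
  #-disjoint f g h = subst (# P? + # Q? ≤_) (trans (cong (# A? +_) (#-∅ {n})) (+-identityʳ _))
    (#-exchange P? Q? A? ∅? (λ p → inj₁ (f p)) (λ q → inj₁ (g q)) (λ p q → ⊥-elim (h p q)))

module _ {n : ℕ} {A P : Pred (Fin n) 0ℓ} (A? : Decidable A) (P? : Decidable P) where

  #-mono : (∀ {i} → A i → P i) → # A? ≤ # P?
  #-mono f = subst (# A? ≤_) (trans (cong (# P? +_) (#-∅ {n})) (+-identityʳ _)) (#-cover A? P? ∅? (λ a → inj₁ (f a)))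

module _ {m n : ℕ} {P : Pred (Fin n) 0ℓ} {Q : Pred (Fin m) 0ℓ} (P? : Decidable P) (Q? : Decidable Q) where

  #-image : (f : Fin m → Fin n) → (∀ {w} → P w → ∃ λ h → Q h × f h ≡ w) → # P? ≤ # Q?
  #-image f sur = subst (# P? ≤_) (length-map f (filter Q? (allFin m)))
    (unique-⊆⇒length≤ (Uniqueₚ.filter⁺ P? (Uniqueₚ.allFin⁺ n)) incl)
    where
    incl : ∀ {w} → w ∈ₗ filter P? (allFin n) → w ∈ₗ map f (filter Q? (allFin m))
    incl w∈ with ∈-filter⁻ P? {xs = allFin n} w∈
    ... | _ , p with sur p
    ... | h , q , refl = ∈-map⁺ f (∈-filter⁺ Q? (∈-allFin h) q)

#-≤ : ∀ {n} {P : Pred (Fin n) 0ℓ} (P? : Decidable P) → # P? ≤ n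
#-≤ {n} P? = subst (# P? ≤_) #-U (#-mono P? U? (λ _ → tt))

#-single≤1 : ∀ {n} (v : Fin n) → # (_≟ᶠ v) ≤ 1
#-single≤1 v = #-image (_≟ᶠ v) U? (λ (_ : Fin 1) → v) (λ eq → zero , tt , sym eq)

#-inhabited : ∀ {n} {P : Pred (Fin n) 0ℓ} (P? : Decidable P) {v} → P v → 1 ≤ # P?
#-inhabited P? {v} p = #-image U? P? (λ _ → zero {0}) (λ { {zero} _ → v , p , refl })

#-strict : ∀ {n} {A P : Pred (Fin n) 0ℓ} (A? : Decidable A) (P? : Decidable P) →
  (∀ {i} → A i → P i) → ∀ {v} → P v → ¬ A v → # A? < # P?
#-strict A? P? f {v} p ¬a = ≤-trans (≤-reflexive (+-comm 1 _))
  (≤-trans (+-monoʳ-≤ (# A?) (#-inhabited (_≟ᶠ v) refl))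
    (#-disjoint P? A? (_≟ᶠ v) f (λ { refl → p }) (λ { a refl → ¬a a })))

-- Extendable states of a bipartite graph

-- dead slots are never used; owned x marks a slot handed to the left vertex x
data Slot (N : ℕ) : Set where
  free dead : Slot N
  owned     : Fin N → Slot N

module _ {N : ℕ} where

  free? : (a : Slot N) → Dec (a ≡ free)
  free? free      = yes refl
  free? dead      = no λ ()
  free? (owned _) = no λ ()

  owned? : (x : Fin N) (a : Slot N) → Dec (a ≡ owned x)
  owned? x free      = no λ ()
  owned? x dead      = no λ ()
  owned? x (owned y) with y ≟ᶠ x
  ... | yes refl = yes refl
  ... | no y≢x   = no λ { refl → y≢x refl }

size : ∀ {N} → Subset N → ℕ
size X = # (_∈ₛ? X)

size-∪-∩ : ∀ {N} (X Y : Subset N) → size X + size Y ≤ size (X ∪ Y) + size (X ∩ Y)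
size-∪-∩ X Y = #-exchange (_∈ₛ? X) (_∈ₛ? Y) (_∈ₛ? (X ∪ Y)) (_∈ₛ? (X ∩ Y))
  (λ p → inj₁ (x∈p∪q⁺ (inj₁ p))) (λ q → inj₁ (x∈p∪q⁺ (inj₂ q)))
  (λ p q → x∈p∪q⁺ (inj₁ p) , x∈p∩q⁺ (p , q))

size-∪ : ∀ {N} (X Y : Subset N) → size (X ∪ Y) ≤ size X + size Y
size-∪ X Y = #-cover (_∈ₛ? (X ∪ Y)) (_∈ₛ? X) (_∈ₛ? Y) (x∈p∪q⁻ X Y)

size-∪-disjoint : ∀ {N} (X Y : Subset N) → (∀ {x} → x ∈ₛ X → x ∈ₛ Y → ⊥) → size X + size Y ≤ size (X ∪ Y)
size-∪-disjoint X Y d = #-disjoint (_∈ₛ? (X ∪ Y)) (_∈ₛ? X) (_∈ₛ? Y)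
  (λ p → x∈p∪q⁺ (inj₁ p)) (λ q → x∈p∪q⁺ (inj₂ q)) d

size-∅ : ∀ {N} → size (∅ₛ {N}) ≡ 0
size-∅ {N} = n≤0⇒n≡0 (≤-trans (#-mono {N} (_∈ₛ? ∅ₛ) (∅? {A = Fin N}) λ p → ∉⊥ p) (≤-reflexive (#-∅ {N})))

module Expander {N n : ℕ} (R : Fin N → Fin n → Set) (R? : ∀ x w → Dec (R x w)) (s D : ℕ) where

  State : Set
  State = Fin n → Slot N

  Avail : State → Subset N → Fin n → Set
  Avail σ X w = ∃ λ x → x ∈ₛ X × ((σ w ≡ free × R x w) ⊎ σ w ≡ owned x)

  abstract
    Avail? : ∀ σ X → Decidable (Avail σ X)
    Avail? σ X w = any? λ x → (x ∈ₛ? X) ×-dec ((free? (σ w) ×-dec R? x w) ⊎-dec owned? x (σ w))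

  -- Hall-type condition; since slots owned by X count for X, releasing a slot cannot destroy it
  Extendable : State → Set
  Extendable σ = ∀ X → size X ≤ 2 * s → D * size X ≤ # (Avail? σ X)

  Used : State → Fin n → Set
  Used σ w = σ w ≢ free

  abstract
    Used? : ∀ σ → Decidable (Used σ)
    Used? σ w = ¬? (free? (σ w))

  children : State → Fin N → ℕ
  children σ x = # (λ w → owned? x (σ w))

  NonNbr : Subset N → Fin n → Set
  NonNbr X w = ∀ x → x ∈ₛ X → ¬ R x w

  abstract
    NonNbr? : ∀ X → Decidable (NonNbr X)
    NonNbr? X w = all? λ x → (x ∈ₛ? X) →-dec ¬? (R? x w)

  -- Taking the non-neighbours of `X` as the second set turns "an edge between any two sets of at
  -- least `s` vertices" into this count.
  Joined : Set
  Joined = ∀ X → s ≤ size X → # (NonNbr? X) < s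

  Valid : State → Set
  Valid σ = ∀ w x → σ w ≡ owned x → R x w

  infix 4 _≼_
  -- `σ` arises from `τ` by turning some slots free; slots still used keep their owner.
  _≼_ : State → State → Set
  σ ≼ τ = ∀ w → (σ w ≡ free) ⊎ (σ w ≡ τ w)

  ≼-refl : ∀ {σ} → σ ≼ σ
  ≼-refl w = inj₂ refl

  ≼-trans : ∀ {σ τ υ} → σ ≼ τ → τ ≼ υ → σ ≼ υ
  ≼-trans p q w with p w
  ... | inj₁ f = inj₁ f
  ... | inj₂ e with q w
  ...   | inj₁ f = inj₁ (trans e f)
  ...   | inj₂ f = inj₂ (trans e f)

  ≼-free : ∀ {σ τ} → σ ≼ τ → ∀ {w} → τ w ≡ free → σ w ≡ free
  ≼-free p {w} f with p w
  ... | inj₁ g = g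
  ... | inj₂ g = trans g f

  ≼-used : ∀ {σ τ} → σ ≼ τ → ∀ {w} → Used σ w → σ w ≡ τ w
  ≼-used p {w} u with p w
  ... | inj₁ g = contradiction g u
  ... | inj₂ g = g

  -- No available slot is lost: one that was owned by a member of `X` and has been released is now
  -- free and, by `Valid`, adjacent to that member.
  extendable-≼ : ∀ {σ τ} → σ ≼ τ → Valid τ → Extendable τ → Extendable σ
  extendable-≼ {σ} {τ} p val e X small = ≤-trans (e X small) (#-mono (Avail? τ X) (Avail? σ X) incl)
    where
    incl : ∀ {w} → Avail τ X w → Avail σ X w
    incl (x , x∈ , inj₁ (f , r)) = x , x∈ , inj₁ (≼-free p f , r)
    incl {w} (x , x∈ , inj₂ o) with p w
    ... | inj₁ f = x , x∈ , inj₁ (f , val w x o)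
    ... | inj₂ g = x , x∈ , inj₂ (trans g o)

  abstract
    assign : State → Fin n → Fin N → State
    assign σ v x w with w ≟ᶠ v
    ... | yes _ = owned x
    ... | no _  = σ w

    assign-same : ∀ σ v x → assign σ v x v ≡ owned x
    assign-same σ v x with v ≟ᶠ v
    ... | yes _ = refl
    ... | no v≢v = contradiction refl v≢v

    assign-other : ∀ σ v x {w} → w ≢ v → assign σ v x w ≡ σ w
    assign-other σ v x {w} w≢v with w ≟ᶠ v
    ... | yes w≡v = contradiction w≡v w≢v
    ... | no _ = refl

    assign-≼ : ∀ {σ v x} → σ v ≡ free → σ ≼ assign σ v x
    assign-≼ {σ} {v} {x} f w with w ≟ᶠ v
    ... | yes refl = inj₁ f
    ... | no _ = inj₂ refl

    assign-below : ∀ {σ τ v x} → σ ≼ τ → τ v ≡ owned x → assign σ v x ≼ τ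
    assign-below {v = v} p o w with w ≟ᶠ v
    ... | yes refl = inj₂ (sym o)
    ... | no _ = p w

    assign-owned : ∀ σ v x {w y} → assign σ v x w ≡ owned y → (w ≡ v × y ≡ x) ⊎ (w ≢ v × σ w ≡ owned y)
    assign-owned σ v x {w} o with w ≟ᶠ v
    assign-owned σ v x refl | yes w≡v = inj₁ (w≡v , refl)
    assign-owned σ v x o    | no w≢v  = inj₂ (w≢v , o)

    assign-valid : ∀ {σ v x} → Valid σ → R x v → Valid (assign σ v x)
    assign-valid {σ} {v} {x} val r w y o with assign-owned σ v x {w} o
    ... | inj₁ (refl , refl) = r
    ... | inj₂ (_ , o′) = val w y o′

    assign-used : ∀ σ v x → # (Used? (assign σ v x)) ≤ # (Used? σ) + 1
    assign-used σ v x = ≤-trans (#-cover (Used? (assign σ v x)) (Used? σ) (_≟ᶠ v) split)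
                                (+-monoʳ-≤ (# (Used? σ)) (#-single≤1 v))
      where
      split : ∀ {w} → Used (assign σ v x) w → Used σ w ⊎ w ≡ v
      split {w} u with w ≟ᶠ v
      ... | yes e = inj₂ e
      ... | no _  = inj₁ u

  -- The count shared by `large` and `outer-large`: `n` vertices are covered by `a` good ones, `u`
  -- blocked ones and fewer than `s` missed ones.
  room-arith : ∀ {a u v k} → n ≤ a + (u + v) → v < s → u + s + k ≤ n → k < a
  room-arith {a} {u} {v} {k} n≤ v<s room with k <? a
  ... | yes p = p
  ... | no k≮a = contradiction (begin-strict
    n             ≤⟨ n≤ ⟩
    a + (u + v)   ≤⟨ +-monoˡ-≤ (u + v) (≮⇒≥ k≮a) ⟩
    k + (u + v)   <⟨ +-monoʳ-< k (+-monoʳ-< u v<s) ⟩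
    k + (u + s)   ≡⟨ +-comm k (u + s) ⟩
    u + s + k     ≤⟨ room ⟩
    n             ∎) (<-irrefl refl)
    where open ≤-Reasoning

  -- Every slot is available to `X`, used, or a non-neighbour of `X`, and joinedness leaves fewer
  -- than `s` of the last kind.
  large : Joined → ∀ {σ k} → # (Used? σ) + s + k ≤ n → ∀ X → s ≤ size X → k < # (Avail? σ X)
  large joined {σ} room X big =
    room-arith {a = # (Avail? σ X)} {u = # (Used? σ)} {v = # (NonNbr? X)} total (joined X big) room
    where
    split : ∀ {w} → Avail σ X w ⊎ (Used σ w ⊎ NonNbr X w)
    split {w} with Avail? σ X w | free? (σ w)
    ... | yes a | _     = inj₁ a
    ... | no ¬a | no u  = inj₂ (inj₁ u)
    ... | no ¬a | yes f = inj₂ (inj₂ λ x x∈ r → ¬a (x , x∈ , inj₁ (f , r)))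
    total : n ≤ # (Avail? σ X) + (# (Used? σ) + # (NonNbr? X))
    total = begin
      n ≡⟨ #-U ⟨
      # {n} {U} U? ≤⟨ #-cover U? (Avail? σ X) (Used? σ ∪? NonNbr? X) (λ _ → split) ⟩
      # (Avail? σ X) + # (Used? σ ∪? NonNbr? X)
        ≤⟨ +-monoʳ-≤ (# (Avail? σ X)) (#-cover (Used? σ ∪? NonNbr? X) (Used? σ) (NonNbr? X) (λ p → p)) ⟩
      # (Avail? σ X) + (# (Used? σ) + # (NonNbr? X)) ∎
      where open ≤-Reasoning

  -- Tight sets and the extension by one slot

  module _ (1≤s : 1 ≤ s) (joined : Joined) {σ : State} (ext : Extendable σ)
           (room : # (Used? σ) + s + D * (2 * s) ≤ n) where

    -- From size `s` on, `large` gives more than `D * (2 * s)` available slots, which is too many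
    -- for tightness up to size `2 * s`.
    tight⇒small : ∀ X → size X ≤ 2 * s → # (Avail? σ X) ≤ D * size X → size X < s
    tight⇒small X X≤2s tight with s ≤? size X
    ... | no s≰ = ≰⇒> s≰
    ... | yes big = contradiction (<-≤-trans (large joined {σ} room X big) (≤-trans tight (*-monoʳ-≤ D X≤2s))) (<-irrefl refl)

    avail-submodular : ∀ X Y →
      # (Avail? σ (X ∪ Y)) + # (Avail? σ (X ∩ Y)) ≤ # (Avail? σ X) + # (Avail? σ Y)
    avail-submodular X Y = #-exchange (Avail? σ (X ∪ Y)) (Avail? σ (X ∩ Y)) (Avail? σ X) (Avail? σ Y)
      onion (λ p → inj₁ (proj₁ (both p))) (λ _ → both)
      where
      onion : ∀ {w} → Avail σ (X ∪ Y) w → Avail σ X w ⊎ Avail σ Y w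
      onion (x , x∈ , a) with x∈p∪q⁻ X Y x∈
      ... | inj₁ p = inj₁ (x , p , a)
      ... | inj₂ q = inj₂ (x , q , a)
      both : ∀ {w} → Avail σ (X ∩ Y) w → Avail σ X w × Avail σ Y w
      both (x , x∈ , a) with x∈p∩q⁻ X Y x∈
      ... | p , q = (x , p , a) , (x , q , a)

    module _ (x : Fin N) where

      -- Under `ext` the middle inequality is an equality. Only sets avoiding `x` can obstruct a new
      -- child of `x`: a set containing `x` still counts the slot once `x` owns it.
      Tight : Subset N → Set
      Tight X = size X < s × # (Avail? σ X) ≤ D * size X × x ∉ₛ X

      -- Uncrossing: submodularity of availability, with `ext` bounding the intersection from below,
      -- makes the union tight. Its size is at most `2 * s`, so `tight⇒small` brings it back below
      -- `s`.
      tight-∪ : ∀ {X Y} → Tight X → Tight Y → Tight (X ∪ Y)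
      tight-∪ {X} {Y} (X<s , tX , x∉X) (Y<s , tY , x∉Y) =
        tight⇒small (X ∪ Y) ∪≤2s tight , tight , x∉
        where
        open ≤-Reasoning
        x∉ : x ∉ₛ X ∪ Y
        x∉ x∈ with x∈p∪q⁻ X Y x∈
        ... | inj₁ p = x∉X p
        ... | inj₂ q = x∉Y q
        ∪≤2s : size (X ∪ Y) ≤ 2 * s
        ∪≤2s = begin
          size (X ∪ Y)      ≤⟨ size-∪ X Y ⟩
          size X + size Y   ≤⟨ +-mono-≤ (<⇒≤ X<s) (<⇒≤ Y<s) ⟩
          s + s             ≡⟨ cong (s +_) (sym (+-identityʳ s)) ⟩
          2 * s             ∎
        ∩≤2s : size (X ∩ Y) ≤ 2 * s
        ∩≤2s = begin
          size (X ∩ Y) ≤⟨ #-mono (_∈ₛ? (X ∩ Y)) (_∈ₛ? X) (λ p → proj₁ (x∈p∩q⁻ X Y p)) ⟩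
          size X       ≤⟨ <⇒≤ X<s ⟩
          s            ≤⟨ m≤m+n s _ ⟩
          2 * s        ∎
        tight : # (Avail? σ (X ∪ Y)) ≤ D * size (X ∪ Y)
        tight = +-cancelʳ-≤ (D * size (X ∩ Y)) _ _ (begin
          # (Avail? σ (X ∪ Y)) + D * size (X ∩ Y)        ≤⟨ +-monoʳ-≤ (# (Avail? σ (X ∪ Y))) (ext (X ∩ Y) ∩≤2s) ⟩
          # (Avail? σ (X ∪ Y)) + # (Avail? σ (X ∩ Y))    ≤⟨ avail-submodular X Y ⟩
          # (Avail? σ X) + # (Avail? σ Y)                ≤⟨ +-mono-≤ tX tY ⟩
          D * size X + D * size Y                        ≡⟨ *-distribˡ-+ D (size X) (size Y) ⟨
          D * (size X + size Y)                          ≤⟨ *-monoʳ-≤ D (size-∪-∩ X Y) ⟩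
          D * (size (X ∪ Y) + size (X ∩ Y))              ≡⟨ *-distribˡ-+ D (size (X ∪ Y)) (size (X ∩ Y)) ⟩
          D * size (X ∪ Y) + D * size (X ∩ Y)            ∎)

      tight-∅ : Tight ∅ₛ
      tight-∅ = subst (_< s) (sym (size-∅ {N})) 1≤s ,
        subst (# (Avail? σ ∅ₛ) ≤_) (trans (#-∅ {n}) (sym (trans (cong (D *_) (size-∅ {N})) (*-zeroʳ D))))
          (#-mono (Avail? σ ∅ₛ) ∅? λ { (_ , x∈ , _) → ∉⊥ x∈ }) ,
        ∉⊥

      Candidate : Fin n → Set
      Candidate v = σ v ≡ free × R x v

      Witness : Fin n → Set
      Witness v = ∃ λ X → Tight X × Avail σ X v

      -- By closure under union, a single tight set absorbs the witnesses of all candidates in the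
      -- list.
      merge : (∀ v → Candidate v → Witness v) → ∀ vs →
        ∃ λ X → Tight X × (∀ {v} → v ∈ₗ vs → Candidate v → Avail σ X v)
      merge wit [] = ∅ₛ , tight-∅ , λ ()
      merge wit (v ∷ vs) with merge wit vs | free? (σ v) ×-dec R? x v
      ... | X , tX , cov | no ¬c = X , tX , λ { (here refl) c → contradiction c ¬c ; (there v∈) c → cov v∈ c }
      ... | X , tX , cov | yes c with wit v c
      ...   | Y , tY , (y , y∈ , a) = X ∪ Y , tight-∪ tX tY , λ
        { (here refl) _  → y , x∈p∪q⁺ (inj₂ y∈) , a
        ; (there v∈) c′ → let (z , z∈ , b) = cov v∈ c′ in z , x∈p∪q⁺ (inj₁ z∈) , b }

      -- Adding `x` to `X` raises the required number of slots by `D`, but gains only slots that `x`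
      -- already owns, of which there are fewer than `D`. This contradicts `ext`.
      no-cover : children σ x < D → ∀ X → Tight X → (∀ v → Candidate v → Avail σ X v) → ⊥
      no-cover few X (X<s , tX , x∉X) cov = <-irrefl refl (begin-strict
        D * (size X + 1)                       ≤⟨ *-monoʳ-≤ D (≤-trans (+-monoʳ-≤ (size X) (#-inhabited (_∈ₛ? ⁅ x ⁆) (x∈⁅x⁆ x)))
                                                     (size-∪-disjoint X ⁅ x ⁆ λ p q → x∉X (subst (_∈ₛ X) (x∈⁅y⁆⇒x≡y x q) p))) ⟩
        D * size (X ∪ ⁅ x ⁆)                   ≤⟨ ext (X ∪ ⁅ x ⁆) ∪≤2s ⟩
        # (Avail? σ (X ∪ ⁅ x ⁆))               ≤⟨ #-cover (Avail? σ (X ∪ ⁅ x ⁆)) (Avail? σ X) (λ w → owned? x (σ w)) split ⟩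
        # (Avail? σ X) + children σ x          <⟨ +-mono-≤-< tX few ⟩
        D * size X + D                         ≡⟨ cong (D * size X +_) (*-identityʳ D) ⟨
        D * size X + D * 1                     ≡⟨ *-distribˡ-+ D (size X) 1 ⟨
        D * (size X + 1)                       ∎)
        where
        open ≤-Reasoning
        ⁅x⁆≤1 : size ⁅ x ⁆ ≤ 1
        ⁅x⁆≤1 = ≤-trans (#-mono (_∈ₛ? ⁅ x ⁆) (_≟ᶠ x) (x∈⁅y⁆⇒x≡y x)) (#-single≤1 x)
        ∪≤2s : size (X ∪ ⁅ x ⁆) ≤ 2 * s
        ∪≤2s = begin
          size (X ∪ ⁅ x ⁆)      ≤⟨ size-∪ X ⁅ x ⁆ ⟩
          size X + size ⁅ x ⁆   ≤⟨ +-monoʳ-≤ (size X) ⁅x⁆≤1 ⟩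
          size X + 1            ≡⟨ +-comm (size X) 1 ⟩
          suc (size X)          ≤⟨ X<s ⟩
          s                     ≤⟨ m≤m+n s _ ⟩
          2 * s                 ∎
        split : ∀ {w} → Avail σ (X ∪ ⁅ x ⁆) w → Avail σ X w ⊎ σ w ≡ owned x
        split {w} (y , y∈ , a) with x∈p∪q⁻ X ⁅ x ⁆ y∈
        ... | inj₁ p = inj₁ (y , p , a)
        ... | inj₂ q with x∈⁅y⁆⇒x≡y x q
        split {w} (y , y∈ , inj₁ c) | inj₂ q | refl = inj₁ (cov w c)
        split {w} (y , y∈ , inj₂ o) | inj₂ q | refl = inj₂ o

      violation⇒witness : ∀ {v} → Candidate v → ∀ X → size X ≤ 2 * s →
        # (Avail? (assign σ v x) X) < D * size X → Witness v
      violation⇒witness {v} (f , r) X X≤2s viol = X , (tight⇒small X X≤2s tight , tight , x∉X) , v∈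
        where
        open ≤-Reasoning
        σ′ : State
        σ′ = assign σ v x
        keep : ∀ {w} → w ≢ v → Avail σ X w → Avail σ′ X w
        keep w≢v (y , y∈ , inj₁ (g , p)) = y , y∈ , inj₁ (trans (assign-other σ v x w≢v) g , p)
        keep w≢v (y , y∈ , inj₂ o)       = y , y∈ , inj₂ (trans (assign-other σ v x w≢v) o)
        not-⊆ : ¬ (∀ {w} → Avail σ X w → Avail σ′ X w)
        not-⊆ sub = <-irrefl refl (begin-strict
          D * size X         ≤⟨ ext X X≤2s ⟩
          # (Avail? σ X)     ≤⟨ #-mono (Avail? σ X) (Avail? σ′ X) sub ⟩
          # (Avail? σ′ X)    <⟨ viol ⟩
          D * size X         ∎)
        tight : # (Avail? σ X) ≤ D * size X
        tight = begin
          # (Avail? σ X)                     ≤⟨ #-cover (Avail? σ X) (Avail? σ′ X) (_≟ᶠ v) split ⟩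
          # (Avail? σ′ X) + # (_≟ᶠ v)        ≤⟨ +-monoʳ-≤ (# (Avail? σ′ X)) (#-single≤1 v) ⟩
          # (Avail? σ′ X) + 1                ≡⟨ +-comm _ 1 ⟩
          suc (# (Avail? σ′ X))              ≤⟨ viol ⟩
          D * size X                         ∎
          where
          split : ∀ {w} → Avail σ X w → Avail σ′ X w ⊎ w ≡ v
          split {w} a = [ inj₂ , (λ w≢v → inj₁ (keep w≢v a)) ]′ (toSum (w ≟ᶠ v))
        v∈ : Avail σ X v
        v∈ with Avail? σ X v
        ... | yes a = a
        ... | no ¬a = contradiction (λ {w} a → keep (λ { refl → ¬a a }) a) not-⊆
        x∉X : x ∉ₛ X
        x∉X x∈ = not-⊆ λ {w} a → sub w a
          where
          sub : ∀ w → Avail σ X w → Avail σ′ X w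
          sub w a = [ (λ { refl → x , x∈ , inj₂ (assign-same σ v x) }) , (λ w≢v → keep w≢v a) ]′ (toSum (w ≟ᶠ v))

      Violation : Fin n → Subset N → Set
      Violation v X = size X ≤ 2 * s × # (Avail? (assign σ v x) X) < D * size X

      violation? : ∀ v → Dec (∃ (Violation v))
      violation? v = anySubset? λ X → (size X ≤? 2 * s) ×-dec (# (Avail? (assign σ v x) X) <? D * size X)

      abstract
        -- All subsets are searched for a violation. If every candidate has one, the merged tight
        -- witness covers all candidates, which `no-cover` forbids.
        extend : children σ x < D → ∃ λ v → σ v ≡ free × R x v × Extendable (assign σ v x)
        extend few with any? (λ v → (free? (σ v) ×-dec R? x v) ×-dec ¬? (violation? v))
        ... | yes (v , (f , r) , ¬viol) = v , f , r , λ X X≤2s → ≮⇒≥ λ lt → ¬viol (X , X≤2s , lt)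
        ... | no none with merge witness (allFin n)
          where
          witness : ∀ v → Candidate v → Witness v
          witness v c with violation? v
          ... | yes (X , X≤2s , lt) = violation⇒witness c X X≤2s lt
          ... | no ¬viol = contradiction (v , c , ¬viol) none
        ...   | X , tX , cov = ⊥-elim (no-cover few X tX λ v → cov (∈-allFin v))

-- The initial state

module Initial {N n : ℕ} (R₀ : Fin N → Fin n → Set) (R₀? : ∀ x w → Dec (R₀ x w)) (s D : ℕ)
               (pr : Fin N → Fin n) (1≤s : 1 ≤ s) (joined₀ : Expander.Joined R₀ R₀? s D)
               (room₀ : 3 * s + D * (2 * s) ≤ n) where

  Shadow : Subset N → Fin n → Set
  Shadow Z w = ∃ λ x → x ∈ₛ Z × pr x ≡ w

  abstract
    Shadow? : ∀ Z → Decidable (Shadow Z)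
    Shadow? Z w = any? λ x → (x ∈ₛ? Z) ×-dec (pr x ≟ᶠ w)

  #-Shadow : ∀ Z → # (Shadow? Z) ≤ size Z
  #-Shadow Z = #-image (Shadow? Z) (_∈ₛ? Z) pr (λ p → p)

  Outer : Subset N → Fin n → Set
  Outer Z w = (∃ λ x → x ∈ₛ Z × R₀ x w) × ¬ Shadow Z w

  abstract
    Outer? : ∀ Z → Decidable (Outer Z)
    Outer? Z w = any? (λ x → (x ∈ₛ? Z) ×-dec R₀? x w) ×-dec ¬? (Shadow? Z w)

  Bad : Subset N → Set
  Bad Z = size Z < s × # (Outer? Z) ≤ D * size Z

  Bad? : Decidable Bad
  Bad? Z = (size Z <? s) ×-dec (# (Outer? Z) ≤? D * size Z)

  Maximal : Subset N → Set
  Maximal Z = Bad Z × (∀ Y → Bad Y → size Y ≤ size Z)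

  abstract
    maximal : ∃ Maximal
    maximal = climb s ∅ₛ (subst (_< s) (sym (size-∅ {N})) 1≤s , ∅-outer) (m≤m+n s _)
      where
      ∅-outer : # (Outer? ∅ₛ) ≤ D * size (∅ₛ {N})
      ∅-outer = ≤-trans (#-mono {n} (Outer? ∅ₛ) (∅? {A = Fin n}) λ { ((_ , x∈ , _) , _) → ∉⊥ x∈ })
                        (≤-trans (≤-reflexive (#-∅ {n})) z≤n)
      -- The counter bounds the remaining enlargements: `s ≤ k + size Z` persists while `Z` grows,
      -- and a bad set has fewer than `s` elements.
      climb : ∀ k Z → Bad Z → s ≤ k + size Z → ∃ Maximal
      climb zero Z (Z<s , _) s≤ = contradiction (<-≤-trans Z<s s≤) (<-irrefl refl)
      climb (suc k) Z bad s≤ with anySubset? (λ Y → Bad? Y ×-dec (size Z <? size Y))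
      ... | yes (Y , badY , Z<Y) = climb k Y badY
        (≤-trans s≤ (≤-trans (≤-reflexive (sym (+-suc k (size Z)))) (+-monoʳ-≤ k Z<Y)))
      ... | no none = Z , bad , λ Y badY → ≮⇒≥ λ lt → none (Y , badY , lt)

  X₀ : Subset N
  X₀ = proj₁ maximal

  X₀-bad : Bad X₀
  X₀-bad = proj₁ (proj₂ maximal)

  X₀-maximal : ∀ Y → Bad Y → size Y ≤ size X₀
  X₀-maximal = proj₂ (proj₂ maximal)

  -- Members of the maximal bad set are joined to everything, so that they cannot violate
  -- extendability; they sit over dead vertices, so these fake edges are never used.
  R : Fin N → Fin n → Set
  R x w = R₀ x w ⊎ x ∈ₛ X₀

  R? : ∀ x w → Dec (R x w)
  R? x w = R₀? x w ⊎-dec (x ∈ₛ? X₀)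

  open Expander R R? s D

  σ₀ : State
  σ₀ w with Shadow? X₀ w
  ... | yes _ = dead
  ... | no _  = free

  σ₀-dead : ∀ {x} → x ∈ₛ X₀ → σ₀ (pr x) ≡ dead
  σ₀-dead {x} x∈ with Shadow? X₀ (pr x)
  ... | yes _ = refl
  ... | no ¬p = contradiction (x , x∈ , refl) ¬p

  σ₀-unowned : ∀ {w x} → σ₀ w ≢ owned x
  σ₀-unowned {w} eq with Shadow? X₀ w
  σ₀-unowned () | yes _
  σ₀-unowned () | no _

  σ₀-free : ∀ {w} → ¬ Shadow X₀ w → σ₀ w ≡ free
  σ₀-free {w} ¬p with Shadow? X₀ w
  ... | yes p = contradiction p ¬p
  ... | no _  = refl

  σ₀-used⇒shadow : ∀ {w} → Used σ₀ w → Shadow X₀ w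
  σ₀-used⇒shadow {w} u with Shadow? X₀ w
  ... | yes p = p
  ... | no _  = contradiction refl u

  #-σ₀-used : # (Used? σ₀) ≤ s
  #-σ₀-used = ≤-trans (#-mono (Used? σ₀) (Shadow? X₀) σ₀-used⇒shadow)
                      (≤-trans (#-Shadow X₀) (<⇒≤ (proj₁ X₀-bad)))

  joined : Joined
  joined X big = ≤-<-trans (#-mono (NonNbr? X) (Expander.NonNbr? R₀ R₀? s D X) λ nn x x∈ r → nn x x∈ (inj₁ r))
                           (joined₀ X big)

  private
    K : ℕ
    K = D * (2 * s)

    s+s≤ : ∀ {a b} → a ≤ s → b ≤ s → a + b ≤ 2 * s
    s+s≤ a≤ b≤ = ≤-trans (+-mono-≤ a≤ b≤) (≤-reflexive (cong (s +_) (sym (+-identityʳ s))))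

    room₁ : s + s + K ≤ n
    room₁ = ≤-trans (+-monoˡ-≤ K (+-monoʳ-≤ s (m≤m+n s _))) room₀

  -- A member of `X₀` is adjacent to everything under `R`, so all slots but the at most `s` dead
  -- ones are available.
  σ₀-touching : ∀ X {x} → x ∈ₛ X → x ∈ₛ X₀ → K ≤ # (Avail? σ₀ X)
  σ₀-touching X {x} x∈ x∈₀ = +-cancelˡ-≤ s _ _ (begin
    s + K                           ≤⟨ m≤n+m (s + K) s ⟩
    s + (s + K)                     ≡⟨ +-assoc s s K ⟨
    s + s + K                       ≤⟨ room₁ ⟩
    n                               ≡⟨ #-U ⟨
    # {n} {U} U?                    ≤⟨ #-cover U? (Used? σ₀) (Avail? σ₀ X) (λ {w} _ → split w) ⟩
    # (Used? σ₀) + # (Avail? σ₀ X)  ≤⟨ +-monoˡ-≤ _ #-σ₀-used ⟩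
    s + # (Avail? σ₀ X)             ∎)
    where
    open ≤-Reasoning
    split : ∀ w → Used σ₀ w ⊎ Avail σ₀ X w
    split w with free? (σ₀ w)
    ... | yes f = inj₂ (x , x∈ , inj₁ (f , inj₂ x∈₀))
    ... | no u  = inj₁ u

  -- The shadow of `Z` blocks at most `2 * s` vertices and joinedness misses fewer than `s`; the
  -- term `3 * s` in `room₀` pays for both.
  outer-large : ∀ Z → s ≤ size Z → size Z ≤ 2 * s → K < # (Outer? Z)
  outer-large Z big Z≤2s = room-arith {u = 2 * s} {v = # (NN? Z)} total (joined₀ Z big)
    (≤-trans (≤-reflexive (cong (_+ K) (+-comm (2 * s) s))) room₀)
    where
    open ≤-Reasoning
    NN? = Expander.NonNbr? R₀ R₀? s D
    NN  = Expander.NonNbr R₀ R₀? s D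
    split : ∀ {w} → Outer Z w ⊎ (Shadow Z w ⊎ NN Z w)
    split {w} with Shadow? Z w | any? (λ x → (x ∈ₛ? Z) ×-dec R₀? x w)
    ... | yes p | _     = inj₂ (inj₁ p)
    ... | no ¬p | yes q = inj₁ (q , ¬p)
    ... | no ¬p | no ¬q = inj₂ (inj₂ λ x x∈ r → ¬q (x , x∈ , r))
    total : n ≤ # (Outer? Z) + (2 * s + # (NN? Z))
    total = begin
      n ≡⟨ #-U ⟨
      # {n} {U} U? ≤⟨ #-cover U? (Outer? Z) (Shadow? Z ∪? NN? Z) (λ _ → split) ⟩
      # (Outer? Z) + # (Shadow? Z ∪? NN? Z)
        ≤⟨ +-monoʳ-≤ (# (Outer? Z)) (#-cover (Shadow? Z ∪? NN? Z) (Shadow? Z) (NN? Z) (λ p → p)) ⟩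
      # (Outer? Z) + (# (Shadow? Z) + # (NN? Z))
        ≤⟨ +-monoʳ-≤ (# (Outer? Z)) (+-monoˡ-≤ (# (NN? Z)) (≤-trans (#-Shadow Z) Z≤2s)) ⟩
      # (Outer? Z) + (2 * s + # (NN? Z)) ∎

  -- A violating `X` is nonempty, and `X ∪ X₀` has fewer than `D * size (X ∪ X₀)` outer neighbours.
  -- If this union is smaller than `s` it is a larger bad set, against maximality; otherwise it
  -- contradicts `outer-large`.
  σ₀-disjoint : ∀ X → size X < s → (∀ {x} → x ∈ₛ X → x ∈ₛ X₀ → ⊥) → D * size X ≤ # (Avail? σ₀ X)
  σ₀-disjoint X X<s disj = ≮⇒≥ absurd
    where
    open ≤-Reasoning
    Z : Subset N
    Z = X ∪ X₀
    Z≤2s : size Z ≤ 2 * s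
    Z≤2s = ≤-trans (size-∪ X X₀) (s+s≤ (<⇒≤ X<s) (<⇒≤ (proj₁ X₀-bad)))
    split : ∀ {w} → Outer Z w → Avail σ₀ X w ⊎ Outer X₀ w
    split ((x , x∈ , r) , ¬sh) with x∈p∪q⁻ X X₀ x∈
    ... | inj₁ p = inj₁ (x , p , inj₁ (σ₀-free (λ { (y , y∈ , e) → ¬sh (y , x∈p∪q⁺ (inj₂ y∈) , e) }) , inj₁ r))
    ... | inj₂ q = inj₂ ((x , q , r) , λ { (y , y∈ , e) → ¬sh (y , x∈p∪q⁺ (inj₂ y∈) , e) })
    absurd : ¬ (# (Avail? σ₀ X) < D * size X)
    absurd lt = [ (λ Z<s → <-irrefl refl (<-≤-trans grows (X₀-maximal Z (Z<s , <⇒≤ outer))))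
                , (λ big → <-irrefl refl (<-trans (outer-large Z big Z≤2s) (<-≤-trans outer (*-monoʳ-≤ D Z≤2s)))) ]′
                (<-≤-connex (size Z) s)
      where
      outer : # (Outer? Z) < D * size Z
      outer = begin-strict
        # (Outer? Z)                       ≤⟨ #-cover (Outer? Z) (Avail? σ₀ X) (Outer? X₀) split ⟩
        # (Avail? σ₀ X) + # (Outer? X₀)    <⟨ +-mono-<-≤ lt (proj₂ X₀-bad) ⟩
        D * size X + D * size X₀           ≡⟨ *-distribˡ-+ D (size X) (size X₀) ⟨
        D * (size X + size X₀)             ≤⟨ *-monoʳ-≤ D (size-∪-disjoint X X₀ disj) ⟩
        D * size Z                         ∎
      positive : ∀ a → # (Avail? σ₀ X) < D * a → 1 ≤ a
      positive zero    p = contradiction (subst (# (Avail? σ₀ X) <_) (*-zeroʳ D) p) λ ()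
      positive (suc a) p = s≤s z≤n
      grows : size X₀ < size Z
      grows = ≤-trans (+-monoˡ-≤ (size X₀) (positive (size X) lt)) (size-∪-disjoint X X₀ disj)

  σ₀-extendable : Extendable σ₀
  σ₀-extendable X X≤2s with s ≤? size X
  ... | yes big = <⇒≤ (≤-<-trans (*-monoʳ-≤ D X≤2s)
    (large joined {σ₀} (≤-trans (+-monoˡ-≤ K (+-monoˡ-≤ s #-σ₀-used)) room₁) X big))
  ... | no s≰ with any? (λ x → (x ∈ₛ? X) ×-dec (x ∈ₛ? X₀))
  ...   | yes (x , x∈ , x∈₀) = ≤-trans (*-monoʳ-≤ D X≤2s) (σ₀-touching X x∈ x∈₀)
  ...   | no disj = σ₀-disjoint X (≰⇒> s≰) λ x∈ x∈₀ → disj (_ , x∈ , x∈₀)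

-- A decidable s-joined part of the family

module _ {n : ℕ} {P : Fin n → Set} (P? : Decidable P) where

  toSubset : Subset n
  toSubset = tabulateᵥ (λ i → does (P? i))

  ∈-toSubset⁺ : ∀ {i} → P i → i ∈ₛ toSubset
  ∈-toSubset⁺ {i} p = lookup⇒[]= i toSubset (trans (lookup∘tabulate _ i) (dec-true (P? i) p))

  ∈-toSubset⁻ : ∀ {i} → i ∈ₛ toSubset → P i
  ∈-toSubset⁻ {i} i∈ with P? i | trans (sym (lookup∘tabulate (λ j → does (P? j)) i)) ([]=⇒lookup i∈)
  ... | yes p | _ = p
  ... | no _  | ()

-- The second component may mention the proof of the first, as an exhibited edge mentions the size
-- bounds; by irrelevance, testing one such proof settles all.
Σ-dec-irrelevant : {A : Set} {B : A → Set} → (∀ (a a′ : A) → a ≡ a′) → Dec A → (∀ a → Dec (B a)) → Dec (Σ A B)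
Σ-dec-irrelevant irr (no ¬a) B? = no λ { (a , _) → ¬a a }
Σ-dec-irrelevant irr (yes a) B? with B? a
... | yes b = yes (a , b)
... | no ¬b = no λ { (a′ , b) → ¬b (subst _ (irr a′ a) b) }

module ChosenEdges {n t : ℕ} (s : ℕ) (𝒢 : Fin t → Graph n) (sj : SJoined s 𝒢) (1≤s : 1 ≤ s) where

  record Edge (X : Subset (n * t)) (Y : Subset n) : Set where
    field
      source  : Fin (n * t)
      target  : Fin n
      source∈ : source ∈ₛ X
      target∈ : target ∈ₛ Y
      adj     : Graph.Adj (𝒢 (proj₂ (remQuot {n} t source))) (proj₁ (remQuot {n} t source)) target
  open Edge

  remQuot-injective : ∀ {x y : Fin (n * t)} → remQuot {n} t x ≡ remQuot t y → x ≡ y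
  remQuot-injective {x} {y} eq = trans (sym (combine-remQuot {n} t x))
    (trans (cong (λ (u , i) → combine u i) eq) (combine-remQuot {n} t y))

  abstract
    edge : ∀ X Y → s ≤ size X → s ≤ size Y → Edge X Y
    edge X Y X≥s Y≥s with sj (map (remQuot {n} t) (filter (_∈ₛ? X) (allFin _))) (filter (_∈ₛ? Y) (allFin n))
        (Uniqueₚ.map⁺ remQuot-injective (Uniqueₚ.filter⁺ (_∈ₛ? X) (Uniqueₚ.allFin⁺ _)))
        (Uniqueₚ.filter⁺ (_∈ₛ? Y) (Uniqueₚ.allFin⁺ n))
        (subst (s ≤_) (sym (length-map (remQuot {n} t) (filter (_∈ₛ? X) (allFin _)))) X≥s) Y≥s
    ... | u , i , v , ui∈ , v∈ , uv with ∈-map⁻ (remQuot {n} t) ui∈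
    ...   | x , x∈ , eq = record
      { source  = x
      ; target  = v
      ; source∈ = proj₂ (∈-filter⁻ (_∈ₛ? X) {xs = allFin _} x∈)
      ; target∈ = proj₂ (∈-filter⁻ (_∈ₛ? Y) {xs = allFin n} v∈)
      ; adj     = subst (λ (u , i) → Graph.Adj (𝒢 i) u v) eq uv
      }

  -- The edges of 𝒢 that the hypothesis exhibits on sub-sets.  Adjacency in 𝒢 is an arbitrary
  -- type-valued relation; this finite part of it is decidable and still s-joined.
  Chosen : Fin (n * t) → Fin n → Set
  Chosen x w = ∃₂ λ X Y → Σ (s ≤ size X) λ X≥s → Σ (s ≤ size Y) λ Y≥s →
    source (edge X Y X≥s Y≥s) ≡ x × target (edge X Y X≥s Y≥s) ≡ w

  abstract
    Chosen? : ∀ x w → Dec (Chosen x w)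
    Chosen? x w = anySubset? λ X → anySubset? λ Y →
      Σ-dec-irrelevant ≤-irrelevant (s ≤? size X) λ X≥s →
      Σ-dec-irrelevant ≤-irrelevant (s ≤? size Y) λ Y≥s →
      (_ ≟ᶠ x) ×-dec (_ ≟ᶠ w)

  -- zero is the common parent of the branch roots, suc codes V × [t]
  R₀ : Fin (suc (n * t)) → Fin n → Set
  R₀ zero    w = ⊤
  R₀ (suc x) w = Chosen x w

  R₀? : ∀ x w → Dec (R₀ x w)
  R₀? zero    w = yes tt
  R₀? (suc x) w = Chosen? x w

  code : Fin n → Fin t → Fin (suc (n * t))
  code v i = suc (combine v i)

  -- The projection used for shadows. The common parent lies over no vertex and is sent to `junk`,
  -- so it too accounts for at most one dead slot.
  base : Fin n → Fin (suc (n * t)) → Fin n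
  base junk zero    = junk
  base junk (suc x) = proj₁ (remQuot {n} t x)

  base-code : ∀ junk v i → base junk (code v i) ≡ v
  base-code junk v i = cong proj₁ (remQuot-combine {n} {t} v i)

  R₀-adj : ∀ {v i w} → R₀ (code v i) w → Graph.Adj (𝒢 i) v w
  R₀-adj {v} {i} {w} (X , Y , X≥s , Y≥s , eq , refl) =
    subst (λ (u , i) → Graph.Adj (𝒢 i) u (target e)) (trans (cong (remQuot {n} t) eq) (remQuot-combine {n} {t} v i)) (adj e)
    where e = edge X Y X≥s Y≥s

  -- The common parent misses nothing. Without it, if at least `s` vertices were missed, the edge
  -- chosen for `X` and exactly these vertices would end in a non-neighbour.
  joined₀ : ∀ D → Expander.Joined R₀ R₀? s D
  joined₀ D (b ∷ X) big = [ universal , proper ]′ (toSum (zero ∈ₛ? (b ∷ X)))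
    where
    open Expander R₀ R₀? s D
    universal : zero ∈ₛ b ∷ X → # (NonNbr? (b ∷ X)) < s
    universal z∈ = ≤-<-trans (≤-trans (#-mono {n} (NonNbr? (b ∷ X)) (∅? {A = Fin n}) (λ nn → nn zero z∈ tt))
                                   (≤-reflexive (#-∅ {n}))) 1≤s
    proper : zero ∉ₛ b ∷ X → # (NonNbr? (b ∷ X)) < s
    proper z∉ = ≰⇒> absurd
      where
      X≥s : s ≤ size X
      X≥s = ≤-trans big (#-image (_∈ₛ? (b ∷ X)) (_∈ₛ? X) suc λ
        { {zero} z∈ → contradiction z∈ z∉ ; {suc x} x∈ → x , drop-there x∈ , refl })
      Y : Subset n
      Y = toSubset (NonNbr? (b ∷ X))
      absurd : ¬ (s ≤ # (NonNbr? (b ∷ X)))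
      absurd many = ∈-toSubset⁻ (NonNbr? (b ∷ X)) (target∈ e) (suc (source e)) (there (source∈ e)) (X , Y , X≥s , Y≥s , refl , refl)
        where
        Y≥s : s ≤ size Y
        Y≥s = ≤-trans many (#-mono (NonNbr? (b ∷ X)) (_∈ₛ? Y) (∈-toSubset⁺ (NonNbr? (b ∷ X))))
        e : Edge X Y
        e = edge X Y X≥s Y≥s

-- Growing trees

-- The sum `1 + b + ... + b ^ k`: the number of new vertices in a tree whose root has one child and
-- whose later branchings are all `b`-fold.
geometric : ℕ → ℕ → ℕ
geometric b zero    = 1
geometric b (suc k) = geometric b k + b ^ suc k

module Growth {N n t : ℕ} (R : Fin N → Fin n → Set) (R? : ∀ x w → Dec (R x w)) (s D : ℕ)
              (code : Fin n → Fin t → Fin N) (code-injective : ∀ {u v i j} → code u i ≡ code v j → u ≡ v)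
              (1≤s : 1 ≤ s) (joined : Expander.Joined R R? s D) where

  open Expander R R? s D

  -- Consequently a vertex that is still free owns nothing in any colour, so it starts childless
  -- once it is placed.
  Closed : State → Set
  Closed σ = ∀ {w v i} → σ w ≡ owned (code v i) → Used σ v

  record Good (σ : State) : Set where
    constructor good
    field
      valid      : Valid σ
      extendable : Extendable σ
      closed     : Closed σ
  open Good public

  -- `r` further assignments can be made with the reserve that `extend` demands still left.
  Room : State → ℕ → Set
  Room σ r = r + (# (Used? σ) + s + D * (2 * s)) ≤ n

  owned⇒used : ∀ {σ w y} → σ w ≡ owned y → Used σ w
  owned⇒used o f with trans (sym o) f
  ... | ()

  ≼-Used : ∀ {σ τ} → σ ≼ τ → ∀ {w} → Used σ w → Used τ w
  ≼-Used p u f = u (≼-free p f)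

  room-assign : ∀ {σ v x r} → Room σ (suc r) → Room (assign σ v x) r
  room-assign {σ} {v} {x} {r} room = begin
    r + (# (Used? (assign σ v x)) + s + K)  ≤⟨ +-monoʳ-≤ r (+-monoˡ-≤ K (+-monoˡ-≤ s (assign-used σ v x))) ⟩
    r + (# (Used? σ) + 1 + s + K)           ≡⟨ cong (λ a → r + (a + s + K)) (+-comm (# (Used? σ)) 1) ⟩
    r + suc (# (Used? σ) + s + K)           ≡⟨ +-suc r _ ⟩
    suc r + (# (Used? σ) + s + K)           ≤⟨ room ⟩
    n                                       ∎
    where
    open ≤-Reasoning
    K = D * (2 * s)

  room-weaken : ∀ {σ} q {r} → Room σ (q + r) → Room σ r
  room-weaken q {r} room = ≤-trans (+-monoˡ-≤ _ (m≤n+m r q)) room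

  New : State → State → (Fin N → Set) → Set
  New σ τ Q = ∀ {w y} → τ w ≡ owned y → σ w ≡ owned y ⊎ Q y

  record Step (σ : State) (x : Fin N) (r : ℕ) : Set where
    field
      target  : Fin n
      free-at : σ target ≡ free
      edge    : R x target
      state   : Good (assign σ target x)
      roomy    : Room (assign σ target x) r

  good-assign : ∀ {σ v l i} → Good σ → Used σ l → σ v ≡ free → R (code l i) v → Extendable (assign σ v (code l i)) →
    Good (assign σ v (code l i))
  good-assign {σ} {v} {l} {i} g u f r e = good (assign-valid (valid g) r) e closed′
    where
    grown : ∀ {w} → Used σ w → Used (assign σ v (code l i)) w
    grown = ≼-Used (assign-≼ {σ} {v} f)
    closed′ : Closed (assign σ v (code l i))
    closed′ {w} o with assign-owned σ v (code l i) o
    ... | inj₁ (_ , eq) = grown (subst (Used σ) (sym (code-injective eq)) u)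
    ... | inj₂ (_ , o′) = grown (closed g o′)

  step : ∀ {σ r} l i → Good σ → Used σ l → children σ (code l i) < D → Room σ (suc r) → Step σ (code l i) r
  step {σ} {r} l i g u few room
    with extend 1≤s joined {σ} (extendable g) (room-weaken {σ} (suc r) {0} (subst (Room σ) (sym (+-identityʳ (suc r))) room)) (code l i) few
  ... | v , f , e , ext′ = record
    { target  = v
    ; free-at = f
    ; edge    = e
    ; state   = good-assign g u f e ext′
    ; roomy   = room-assign {σ} {v} {code l i} {r} room
    }

  children-mono : ∀ {σ τ y} {Q : Fin N → Set} → New σ τ Q → ¬ Q y → children τ y ≤ children σ y
  children-mono {σ} {τ} {y = y} new ¬q = #-mono (λ w → owned? y (τ w)) (λ w → owned? y (σ w))
    λ o → [ (λ o′ → o′) , (λ q → contradiction q ¬q) ]′ (new o)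

  children-assign : ∀ {σ v x} → children (assign σ v x) x ≤ children σ x + 1
  children-assign {σ} {v} {x} = ≤-trans
    (#-cover (λ w → owned? x (assign σ v x w)) (λ w → owned? x (σ w)) (_≟ᶠ v) split)
    (+-monoʳ-≤ (children σ x) (#-single≤1 v))
    where
    split : ∀ {w} → assign σ v x w ≡ owned x → σ w ≡ owned x ⊎ w ≡ v
    split {w} o with assign-owned σ v x {w} o
    ... | inj₁ (e , _)  = inj₂ e
    ... | inj₂ (_ , o′) = inj₁ o′

  record Batch (σ : State) (r size : ℕ) (Q : Fin N → Set) : Set where
    field
      τ      : State
      below  : σ ≼ τ
      state  : Good τ
      roomy   : Room τ r
      new    : New σ τ Q
      list   : List (Fin n)
      unique : Unique list
      count  : length list ≡ size
      slots  : ∀ {w} → w ∈ₗ list → σ w ≡ free × ∃ λ y → τ w ≡ owned y × Q y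

  siblings : ∀ b {σ r} l i → Good σ → Used σ l → children σ (code l i) + b ≤ D → Room σ (b + r) →
    Batch σ r b (_≡ code l i)
  siblings zero {σ} l i g u few room = record
    { τ = σ ; below = ≼-refl ; state = g ; roomy = room ; new = inj₁ ; list = [] ; unique = [] ; count = refl ; slots = λ () }
  siblings (suc b) {σ} {r} l i g u few room = record
    { τ      = τ rest
    ; below  = ≼-trans below₁ (below rest)
    ; state  = state rest
    ; roomy  = roomy rest
    ; new    = λ o → [ (λ o₁ → [ (λ { (_ , e) → inj₂ e }) , (λ { (_ , o₂) → inj₁ o₂ }) ]′ (assign-owned σ v x o₁)) , inj₂ ]′ (new rest o)
    ; list   = v ∷ list rest
    ; unique = All.tabulate (λ { w∈ refl → owned⇒used {σ₁} owned-v (proj₁ (slots rest w∈)) }) ∷ unique rest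
    ; count  = cong suc (count rest)
    ; slots  = λ { (here refl) → free-at first , code l i , trans (sym (≼-used (below rest) (owned⇒used {σ₁} owned-v))) owned-v , refl
                 ; (there w∈) → ≼-free below₁ (proj₁ (slots rest w∈)) , proj₂ (slots rest w∈) }
    }
    where
    open Batch
    open Step using (free-at)
    x = code l i
    first : Step σ x (b + r)
    first = step l i g u (≤-trans (s≤s (m≤m+n _ b)) (≤-trans (≤-reflexive (sym (+-suc _ b))) few)) room
    v = Step.target first
    σ₁ = assign σ v x
    below₁ : σ ≼ σ₁
    below₁ = assign-≼ (free-at first)
    owned-v : σ₁ v ≡ owned x
    owned-v = assign-same σ v x
    rest : Batch σ₁ r b (_≡ x)
    rest = siblings b l i (Step.state first) (≼-Used below₁ u)
      (≤-trans (+-monoˡ-≤ b (children-assign {σ} {v} {x}))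
        (≤-trans (≤-reflexive (+-assoc (children σ x) 1 b)) few)) (Step.roomy first)

  level : ∀ b i ls {σ r} → Good σ → Unique ls → (∀ {l} → l ∈ₗ ls → Used σ l × children σ (code l i) + b ≤ D) →
    Room σ (length ls * b + r) → Batch σ r (length ls * b) (λ y → ∃ λ l → l ∈ₗ ls × y ≡ code l i)
  level b i [] {σ} g _ _ room = record
    { τ = σ ; below = ≼-refl ; state = g ; roomy = room ; new = inj₁ ; list = [] ; unique = [] ; count = refl ; slots = λ () }
  level b i (l ∷ ls) {σ} {r} g (l∉ ∷ uls) ok room = record
    { τ      = τ rest
    ; below  = ≼-trans (below first) (below rest)
    ; state  = state rest
    ; roomy  = Batch.roomy rest
    ; new    = λ o → [ (λ o₁ → [ inj₁ , (λ e → inj₂ (l , here refl , e)) ]′ (new first o₁))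
                     , (λ { (l′ , l′∈ , e) → inj₂ (l′ , there l′∈ , e) }) ]′ (new rest o)
    ; list   = list first ++ list rest
    ; unique = Uniqueₚ.++⁺ (unique first) (unique rest) λ { (p , q) → used-first p (proj₁ (slots rest q)) }
    ; count  = trans (length-++ (list first)) (cong₂ _+_ (count first) (count rest))
    ; slots  = λ w∈ → [ from-first , from-rest ]′ (∈-++⁻ (list first) w∈)
    }
    where
    open Batch
    first : Batch σ (length ls * b + r) b (_≡ code l i)
    first = siblings b l i g (proj₁ (ok (here refl))) (proj₂ (ok (here refl))) (subst (Room σ) (+-assoc b (length ls * b) r) room)
    used-first : ∀ {w} → w ∈ₗ list first → Used (τ first) w
    used-first w∈ with slots first w∈
    ... | _ , _ , o , _ = owned⇒used {τ first} o
    rest : Batch (τ first) r (length ls * b) (λ y → ∃ λ l′ → l′ ∈ₗ ls × y ≡ code l′ i)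
    rest = level b i ls (state first) uls
      (λ {l′} l′∈ → ≼-Used (below first) (proj₁ (ok (there l′∈))) ,
        -- All new owners are `code l i`, so the child counts at the remaining, distinct vertices
        -- have not grown.
        ≤-trans (+-monoˡ-≤ b (children-mono {σ} {τ first} (new first)
          λ e → All.lookup l∉ l′∈ (sym (code-injective e)))) (proj₂ (ok (there l′∈))))
      (Batch.roomy first)
    from-first : ∀ {w} → w ∈ₗ list first → σ w ≡ free × ∃ λ y → τ rest w ≡ owned y × ∃ λ l′ → l′ ∈ₗ l ∷ ls × y ≡ code l′ i
    from-first w∈ with slots first w∈
    ... | f , y , o , e = f , y , trans (sym (≼-used (below rest) (owned⇒used {τ first} o))) o , l , here refl , e
    from-rest : ∀ {w} → w ∈ₗ list rest → σ w ≡ free × ∃ λ y → τ rest w ≡ owned y × ∃ λ l′ → l′ ∈ₗ l ∷ ls × y ≡ code l′ i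
    from-rest w∈ with slots rest w∈
    ... | f , y , o , l′ , l′∈ , e = ≼-free (below first) f , y , o , l′ , there l′∈ , e

  -- Each link records the state in which its vertex was still free: replaying the chain
  -- on top of σ therefore never meets an occupied slot.
  data Chain (σ : State) (v : Fin n) (c : ℕ → Fin t) : ℕ → State → Fin n → Set where
    nil  : Chain σ v c 0 σ v
    snoc : ∀ {j τ τ′ l w} → Chain σ v c j τ l → τ ≼ τ′ → τ w ≡ free → τ′ w ≡ owned (code l (c j)) →
           R (code l (c j)) w → Chain σ v c (suc j) τ′ w

  record Leaf (σ : State) (v : Fin n) (c : ℕ → Fin t) (j : ℕ) (τ : State) (w : Fin n) : Set where
    field
      fresh     : σ w ≡ free
      used      : Used τ w
      childless : ∀ {w′ i} → τ w′ ≢ owned (code w i)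
      chain     : Chain σ v c j τ w

  -- The field `new` confines growth to the first colour at `v` and to vertices that were free.
  -- Hence a second tree can start at another embedded vertex whose child counts have not grown.
  record Tree (b : ℕ) (σ : State) (v : Fin n) (c : ℕ → Fin t) (k r : ℕ) : Set where
    field
      τ      : State
      below  : σ ≼ τ
      state  : Good τ
      roomy   : Room τ r
      new    : New σ τ λ y → y ≡ code v (c 0) ⊎ ∃₂ λ u i → y ≡ code u i × σ u ≡ free
      leaves : List (Fin n)
      unique : Unique leaves
      count  : length leaves ≡ b ^ k
      leaf   : ∀ {w} → w ∈ₗ leaves → Leaf σ v c (suc k) τ w

  -- The root `v` may own up to `D ∸ 1` vertices already, so it receives only one child; every later
  -- vertex starts childless and can take `b ≤ D` children.
  grow : ∀ {b} → b ≤ D → ∀ k {σ v c r} → Good σ → Used σ v → children σ (code v (c 0)) < D →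
    Room σ (geometric b k + r) → Tree b σ v c k r
  grow b≤D zero {σ} {v} {c} {r} g u few room = record
    { τ      = σ₁
    ; below  = assign-≼ free-at
    ; state  = state
    ; roomy  = Step.roomy first
    ; new    = λ o → [ (λ { (_ , e) → inj₂ (inj₁ e) }) , (λ { (_ , o′) → inj₁ o′ }) ]′ (assign-owned σ target x o)
    ; leaves = target ∷ []
    ; unique = [] ∷ []
    ; count  = refl
    ; leaf   = λ { (here refl) → record
        { fresh     = free-at
        ; used      = owned⇒used {σ₁} (assign-same σ target x)
        ; childless = childless
        ; chain     = snoc nil (assign-≼ free-at) free-at (assign-same σ target x) edge } }
    }
    where
    x = code v (c 0)
    first : Step σ x r
    first = step v (c 0) g u few room
    open Step first
    σ₁ = assign σ target x
    childless : ∀ {w′ i} → σ₁ w′ ≢ owned (code target i)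
    childless {w′} o with assign-owned σ target x {w′} o
    ... | inj₁ (_ , e)  = subst (Used σ) (sym (code-injective e)) u free-at
    ... | inj₂ (_ , o′) = closed g o′ free-at
  grow {b} b≤D (suc k) {σ} {v} {c} {r} g u few room = record
    { τ      = Batch.τ next
    ; below  = ≼-trans (below prev) (Batch.below next)
    ; state  = Batch.state next
    ; roomy  = Batch.roomy next
    ; new    = λ o → [ new prev , (λ { (l , l∈ , e) → inj₂ (inj₂ (l , _ , e , Leaf.fresh (leaf prev l∈))) }) ]′ (Batch.new next o)
    ; leaves = Batch.list next
    ; unique = Batch.unique next
    ; count  = trans (Batch.count next) (trans (cong (_* b) (count prev)) (*-comm (b ^ k) b))
    ; leaf   = leaf′
    }
    where
    open Tree
    prev : Tree b σ v c k (b ^ suc k + r)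
    prev = grow b≤D k g u few (subst (Room σ) (+-assoc (geometric b k) (b ^ suc k) r) room)
    ls = leaves prev
    no-children : ∀ {l} → l ∈ₗ ls → children (τ prev) (code l (c (suc k))) ≡ 0
    no-children {l} l∈ = n≤0⇒n≡0 (≤-trans
      (#-mono (λ w → owned? (code l (c (suc k))) (τ prev w)) (∅? {A = Fin n}) (λ o → Leaf.childless (leaf prev l∈) o))
      (≤-reflexive (#-∅ {n})))
    next : Batch (τ prev) r (length ls * b) (λ y → ∃ λ l → l ∈ₗ ls × y ≡ code l (c (suc k)))
    next = level b (c (suc k)) ls (state prev) (unique prev)
      (λ l∈ → Leaf.used (leaf prev l∈) , ≤-trans (≤-reflexive (cong (_+ b) (no-children l∈))) b≤D)
      (subst (λ a → Room (τ prev) (a + r)) (trans (*-comm b (b ^ k)) (sym (cong (_* b) (count prev)))) (Tree.roomy prev))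
    leaf′ : ∀ {w} → w ∈ₗ Batch.list next → Leaf σ v c (suc (suc k)) (Batch.τ next) w
    leaf′ {w} w∈ with Batch.slots next w∈
    ... | f , y , o , l , l∈ , refl = record
      { fresh     = ≼-free (below prev) f
      ; used      = owned⇒used {Batch.τ next} o
      ; childless = λ o′ → [ (λ o₁ → closed (state prev) o₁ f)
                           , (λ { (l′ , l′∈ , e) → subst (Used (τ prev)) (sym (code-injective e)) (Leaf.used (leaf prev l′∈)) f }) ]′
                           (Batch.new next o′)
      ; chain     = snoc (Leaf.chain (leaf prev l∈)) (Batch.below next) f o (valid (Batch.state next) _ _ o)
      }

-- Paths of the expansion

-- q 0 is not added: it is expected to lie in Dom
upto : ∀ {A : Set} → (ℕ → A) → ℕ → List A → List A
upto q zero    Dom = Dom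
upto q (suc j) Dom = q (suc j) ∷ upto q j Dom

module _ {A : Set} (q : ℕ → A) where

  ∈-upto⁻ : ∀ j {Dom g} → g ∈ₗ upto q j Dom → g ∈ₗ Dom ⊎ ∃ λ i → i ≤ j × g ≡ q i
  ∈-upto⁻ zero    g∈ = inj₁ g∈
  ∈-upto⁻ (suc j) (here refl) = inj₂ (suc j , ≤-refl , refl)
  ∈-upto⁻ (suc j) (there g∈) with ∈-upto⁻ j g∈
  ... | inj₁ p = inj₁ p
  ... | inj₂ (i , i≤j , eq) = inj₂ (i , m≤n⇒m≤1+n i≤j , eq)

  ∈-upto⁺ˡ : ∀ j {Dom g} → g ∈ₗ Dom → g ∈ₗ upto q j Dom
  ∈-upto⁺ˡ zero    g∈ = g∈
  ∈-upto⁺ˡ (suc j) g∈ = there (∈-upto⁺ˡ j g∈)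

  ∈-upto⁺ʳ : ∀ j {Dom i} → q 0 ∈ₗ Dom → i ≤ j → q i ∈ₗ upto q j Dom
  ∈-upto⁺ʳ zero    q0∈ z≤n = q0∈
  ∈-upto⁺ʳ (suc j) q0∈ i≤ with m≤n⇒m<n∨m≡n i≤
  ... | inj₁ i<   = there (∈-upto⁺ʳ j q0∈ (≤-pred i<))
  ... | inj₂ refl = here refl

-- A path `q 0, ..., q L` with embedded ends and missing interior, no interior vertex having a
-- neighbour off the path or a chord. Values of `q` beyond `L` carry no meaning.
record IsSegment {m t} (H : ColGraph m t) (q : ℕ → Fin m) (L : ℕ) (Dom : List (Fin m)) : Set where
  field
    start∈      : q 0 ∈ₗ Dom
    finish∈     : q L ∈ₗ Dom
    interior∉   : ∀ {j} → 1 ≤ j → j < L → q j ∉ₗ Dom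
    q-injective : ∀ {i j} → i ≤ L → j ≤ L → q i ≡ q j → i ≡ j
    link        : ∀ {j} → j < L → HAdj H (q j) (q (suc j))
    nbrs        : ∀ {j g} → 1 ≤ j → j < L → HAdj H g (q j) →
                  ∃ λ i → i ≤ L × g ≡ q i × (i ≡ suc j ⊎ j ≡ suc i)

module Segment {m t} {H : ColGraph m t} {q : ℕ → Fin m} {L : ℕ} {Dom : List (Fin m)} (seg : IsSegment H q L Dom) where
  open IsSegment seg

  locate : ∀ {i} → i ≤ L → q i ∈ₗ Dom → i ≡ 0 ⊎ i ≡ L
  locate {zero}  _  _ = inj₁ refl
  locate {suc i} i≤ qi∈ with m≤n⇒m<n∨m≡n i≤
  ... | inj₁ i<L = contradiction qi∈ (interior∉ (s≤s z≤n) i<L)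
  ... | inj₂ eq  = inj₂ eq

  locate-upto : ∀ {i j} → i ≤ L → j ≤ L → q i ∈ₗ upto q j Dom → i ≤ j ⊎ i ≡ L
  locate-upto {i} {j} i≤ j≤ qi∈ with ∈-upto⁻ q j qi∈
  ... | inj₁ p = [ (λ { refl → inj₁ z≤n }) , inj₂ ]′ (locate i≤ p)
  ... | inj₂ (a , a≤ , eq) = inj₁ (subst (_≤ j) (sym (q-injective i≤ (≤-trans a≤ j≤) eq)) a≤)

  advance-new : ∀ {i} → suc i < L → q (suc i) ∉ₗ upto q i Dom
  advance-new {i} i<L p = [ <-irrefl refl , (λ eq → <-irrefl eq i<L) ]′
    (locate-upto (<⇒≤ i<L) (≤-trans (n≤1+n i) (<⇒≤ i<L)) p)

  -- The bound keeps the other neighbour `q (suc (suc i))` away from the end `q L`, which already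
  -- lies in `Dom`.
  advance-only : ∀ {i g} → suc (suc i) < L → g ∈ₗ upto q i Dom → HAdj H g (q (suc i)) → g ≡ q i
  advance-only {i} i<L g∈ gq with nbrs (s≤s z≤n) (<-trans (n<1+n _) i<L) gq
  ... | _ , _  , refl , inj₂ refl = refl
  ... | _ , i≤ , refl , inj₁ refl = ⊥-elim ([ (λ lt → <-irrefl refl (<-trans (n<1+n i) lt)) , (λ eq → <-irrefl eq i<L) ]′
        (locate-upto i≤ (≤-trans (n≤1+n _) (≤-trans (n≤1+n _) (<⇒≤ i<L))) g∈))

module _ {A : Set} where

  -- entries past the end of the list are the junk value d
  nth : A → List A → ℕ → A
  nth d []       _       = d
  nth d (x ∷ xs) zero    = x
  nth d (x ∷ xs) (suc j) = nth d xs j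

  module _ (d : A) where

    nth-lookup : ∀ xs (a : Fin (length xs)) → nth d xs (toℕ a) ≡ lookup xs a
    nth-lookup (x ∷ xs) zero    = refl
    nth-lookup (x ∷ xs) (suc a) = nth-lookup xs a

    nth-fromℕ< : ∀ xs {j} (j< : j < length xs) → nth d xs j ≡ lookup xs (fromℕ< j<)
    nth-fromℕ< xs j< = trans (cong (nth d xs) (sym (toℕ-fromℕ< j<))) (nth-lookup xs (fromℕ< j<))

    nth-∈ : ∀ xs {j} → j < length xs → nth d xs j ∈ₗ xs
    nth-∈ xs j< = subst (_∈ₗ xs) (sym (nth-fromℕ< xs j<)) (∈-lookup (fromℕ< j<))

    ∈-nth : ∀ xs {v} → v ∈ₗ xs → ∃ λ j → j < length xs × v ≡ nth d xs j
    ∈-nth xs v∈ = toℕ (index v∈) , toℕ<n (index v∈) , trans (lookup-index v∈) (sym (nth-lookup xs (index v∈)))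

    nth-injective : ∀ {xs} → Unique xs → ∀ {i j} → i < length xs → j < length xs → nth d xs i ≡ nth d xs j → i ≡ j
    nth-injective {xs} u i< j< eq = trans (sym (toℕ-fromℕ< i<)) (trans (cong toℕ
      (lookup-injective u _ _ (trans (sym (nth-fromℕ< xs i<)) (trans eq (nth-fromℕ< xs j<))))) (toℕ-fromℕ< j<))

    nth-linked : ∀ {R : A → A → Set} {xs} → Linked R xs → ∀ {j} → suc j < length xs → R (nth d xs j) (nth d xs (suc j))
    nth-linked [-]     (s≤s ())
    nth-linked (r ∷ _)  {zero}  _        = r
    nth-linked (_ ∷ rs) {suc j} (s≤s j<) = nth-linked rs j<

    nth-head : ∀ xs {v} → head xs ≡ just v → nth d xs 0 ≡ v
    nth-head (x ∷ xs) refl = refl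

    nth-last : ∀ xs {v} → last xs ≡ just v → nth d xs (length xs ∸ 1) ≡ v
    nth-last (x ∷ [])     refl = refl
    nth-last (x ∷ y ∷ xs) eq   = nth-last (y ∷ xs) eq

last-∷ʳ : ∀ {A : Set} (xs : List A) y → last (xs ∷ʳ y) ≡ just y
last-∷ʳ []           y = refl
last-∷ʳ (x ∷ [])     y = refl
last-∷ʳ (x ∷ z ∷ xs) y = last-∷ʳ (z ∷ xs) y

module _ {A : Set} {R : A → A → Set} where

  Linked-∷ʳ : ∀ {xs v y} → Linked R xs → last xs ≡ just v → R v y → Linked R (xs ∷ʳ y)
  Linked-∷ʳ [-]      refl r = r ∷ [-]
  Linked-∷ʳ (s ∷ ss) eq   r = s ∷ Linked-∷ʳ ss eq r

  first-exit : ∀ {P Q : A → Set} (P? : Decidable P) {u v} ws → P u → ¬ P v → All Q (u ∷ ws) → Linked R (u ∷ ws) →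
    last (u ∷ ws) ≡ just v → ∃₂ λ a b → P a × ¬ P b × Q b × R a b
  first-exit P? []       pu ¬pv _ _ refl = contradiction pu ¬pv
  first-exit P? (w ∷ ws) pu ¬pv (_ ∷ qs) (r ∷ rs) eq with P? w
  ... | yes pw = first-exit P? ws pw ¬pv qs rs eq
  ... | no ¬pw = _ , w , pu , ¬pw , All.head qs , r

Unique-∷ʳ : ∀ {A : Set} {xs : List A} {y} → Unique xs → y ∉ₗ xs → Unique (xs ∷ʳ y)
Unique-∷ʳ u y∉ = Uniqueₚ.++⁺ u ([] ∷ []) λ { (x∈ , here refl) → y∉ x∈ }

-- Two tree paths of `suc k` edges each, and the middle edge between them.
segment-length : ∀ k → suc (suc k + suc k) ≡ 2 * k + 3
segment-length = solve-∀

branch-root : ∀ {m t D} {H : ColGraph m t} → ExpansionOfK H D → Fin D → Fin m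
branch-root E y = proj₁ (proj₁ (ExpansionOfK.T-tree E y))

-- Building up an expansion from roots, single vertices and closed paths

module Assembly {m t D k : ℕ} {H : ColGraph m t} (E : ExpansionOfK H D)
  (long : ∀ y z → y <ᶠ z → 2 * k + 3 ≤ length (ExpansionOfK.P E y z) ∸ 1) where

  open ExpansionOfK E
  open import Data.List.Membership.DecPropositional (_≟ᶠ_ {m}) using (_∈?_)

  root : Fin D → Fin m
  root = branch-root E

  HAdj-sym : ∀ {u v} → HAdj H u v → HAdj H v u
  HAdj-sym {u} {v} (i , c) = i , trans (ColGraph.sym H v u) c

  module PathOf {y z : Fin D} (y<z : y <ᶠ z) where

    p : List (Fin m)
    p = P y z

    start finish : Fin m
    start  = proj₁ (P-ends y z y<z)
    finish = proj₁ (proj₂ (P-ends y z y<z))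

    L : ℕ
    L = length p ∸ 1

    length-p : length p ≡ suc L
    length-p = sym (m+[n∸m]≡n (proj₁ (P-path y z y<z)))

    within : ∀ {j} → j ≤ L → j < length p
    within j≤ = ≤-trans (s≤s j≤) (≤-reflexive (sym length-p))

    q : ℕ → Fin m
    q = nth start p

    q-∈ : ∀ {j} → j ≤ L → q j ∈ₗ p
    q-∈ j≤ = nth-∈ start p (within j≤)

    ∈-q : ∀ {v} → v ∈ₗ p → ∃ λ j → j ≤ L × v ≡ q j
    ∈-q v∈ with ∈-nth start p v∈
    ... | j , j< , eq = j , ≤-pred (≤-trans j< (≤-reflexive length-p)) , eq

    q-injective : ∀ {i j} → i ≤ L → j ≤ L → q i ≡ q j → i ≡ j
    q-injective i≤ j≤ = nth-injective start (proj₁ (proj₂ (P-path y z y<z))) (within i≤) (within j≤)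

    link : ∀ {j} → j < L → HAdj H (q j) (q (suc j))
    link j< = nth-linked start (proj₁ (proj₂ (proj₂ (P-path y z y<z)))) (within j<)

    consecutive : ∀ {i j} → i ≤ L → j ≤ L → HAdj H (q i) (q j) → i ≡ suc j ⊎ j ≡ suc i
    consecutive {i} {j} i≤ j≤ adj = subst₂ (λ a b → a ≡ suc b ⊎ b ≡ suc a) (toℕ-fromℕ< (within i≤)) (toℕ-fromℕ< (within j≤))
      (proj₂ (proj₂ (proj₂ (P-path y z y<z))) (fromℕ< (within i≤)) (fromℕ< (within j≤))
        (subst₂ (HAdj H) (nth-fromℕ< start p (within i≤)) (nth-fromℕ< start p (within j≤)) adj))

    q-start : q 0 ≡ start
    q-start = nth-head start p (proj₁ (proj₂ (proj₂ (P-ends y z y<z))))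

    q-finish : q L ≡ finish
    q-finish = nth-last start p (proj₁ (proj₂ (proj₂ (proj₂ (P-ends y z y<z)))))

    start∈T : q 0 ∈ₛ T y
    start∈T = subst (_∈ₛ T y) (sym q-start) (proj₁ (proj₂ (proj₂ (proj₂ (proj₂ (P-ends y z y<z))))))

    finish∈T : q L ∈ₛ T z
    finish∈T = subst (_∈ₛ T z) (sym q-finish) (proj₂ (proj₂ (proj₂ (proj₂ (proj₂ (P-ends y z y<z))))))

    end-position : ∀ {j} → j ≤ L → IsEnd H p (q j) → j ≡ 0 ⊎ j ≡ L
    end-position j≤ (inj₁ e) = inj₁ (q-injective j≤ z≤n (sym (nth-head start p e)))
    end-position j≤ (inj₂ e) = inj₂ (q-injective j≤ ≤-refl (sym (nth-last start p e)))

    end∈T : ∀ {v} → IsEnd H p v → ∃ λ x → v ∈ₛ T x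
    end∈T (inj₁ e) = y , subst (_∈ₛ T y) (nth-head start p e) start∈T
    end∈T (inj₂ e) = z , subst (_∈ₛ T z) (nth-last start p e) finish∈T

    3≤L : 3 ≤ L
    3≤L = ≤-trans (m≤n+m 3 (2 * k)) (long y z y<z)

    -- The path is induced and has length at least 3, so its ends are not consecutive on it.
    ends-apart : ∀ {u v} → IsEnd H p u → IsEnd H p v → u ∈ₗ p → v ∈ₗ p → ¬ HAdj H u v
    ends-apart eu ev u∈ v∈ adj with ∈-q u∈ | ∈-q v∈
    ... | i , i≤ , refl | j , j≤ , refl with end-position i≤ eu | end-position j≤ ev | consecutive i≤ j≤ adj
    ...   | inj₁ refl | inj₁ refl | inj₁ ()
    ...   | inj₁ refl | inj₁ refl | inj₂ ()
    ...   | inj₁ refl | inj₂ refl | inj₂ eq = contradiction (subst (3 ≤_) eq 3≤L) λ { (s≤s ()) }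
    ...   | inj₂ refl | inj₁ refl | inj₁ eq = contradiction (subst (3 ≤_) eq 3≤L) λ { (s≤s ()) }
    ...   | inj₂ refl | inj₂ refl | inj₁ eq = 1+n≢n (sym eq)
    ...   | inj₂ refl | inj₂ refl | inj₂ eq = 1+n≢n (sym eq)

    not-end : ∀ {j} → 1 ≤ j → j < L → ¬ IsEnd H p (q j)
    not-end 1≤j j<L e with end-position (<⇒≤ j<L) e
    ... | inj₁ refl = contradiction 1≤j λ ()
    ... | inj₂ refl = <-irrefl refl j<L

    interior∉T : ∀ {j} → 1 ≤ j → j < L → ∀ {x} → q j ∉ₛ T x
    interior∉T 1≤j j<L {x} qj∈ = not-end 1≤j j<L (proj₂ (TP-disj y z y<z x _ qj∈ (q-∈ (<⇒≤ j<L))))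

  -- A vertex shared by two different paths is an end of one of them. An interior vertex is no end
  -- of its own path, and an end of the other would lie in a branch.
  interior-private : ∀ {y z y′ z′} (y<z : y <ᶠ z) → let open PathOf y<z in y′ <ᶠ z′ → ∀ {j} → 1 ≤ j → j < L →
    q j ∈ₗ P y′ z′ → y ≡ y′ × z ≡ z′
  interior-private {y} {z} {y′} {z′} y<z y′<z′ {j} 1≤j j<L qj∈ =
    same (y ≟ᶠ y′) inj₁ , same (z ≟ᶠ z′) inj₂
    where
    open PathOf y<z
    shared : (y ≢ y′) ⊎ (z ≢ z′) → ⊥
    shared ne with PP-disj y z y′ z′ y<z y′<z′ ne (q j) (q-∈ (<⇒≤ j<L)) qj∈
    ... | inj₁ e = not-end 1≤j j<L e
    ... | inj₂ e = interior∉T 1≤j j<L (proj₂ (PathOf.end∈T y′<z′ e))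
    same : ∀ {a b : Fin D} → Dec (a ≡ b) → (a ≢ b → (y ≢ y′) ⊎ (z ≢ z′)) → a ≡ b
    same (yes eq) _ = eq
    same (no ne)  f = ⊥-elim (shared (f ne))

  interior-nbrs : ∀ {y z} (y<z : y <ᶠ z) → let open PathOf y<z in ∀ {j g} → 1 ≤ j → j < L → HAdj H g (q j) →
    ∃ λ i → i ≤ L × g ≡ q i × (i ≡ suc j ⊎ j ≡ suc i)
  interior-nbrs y<z {j} {g} 1≤j j<L adj with edges _ _ adj
  ... | inj₁ (x , _ , qj∈) = contradiction qj∈ (PathOf.interior∉T y<z 1≤j j<L)
  ... | inj₂ (y′ , z′ , y′<z′ , g∈ , qj∈) with interior-private y<z y′<z′ 1≤j j<L qj∈
  ...   | refl , refl with PathOf.∈-q y<z g∈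
  ...     | i , i≤ , refl = i , i≤ , refl , PathOf.consecutive y<z i≤ (<⇒≤ j<L) adj

  -- An edge lies within one branch or one path. The first contradicts disjointness; in the second
  -- both vertices are ends of that path, against `ends-apart`.
  branches-apart : ∀ {x x′ u v} → x ≢ x′ → u ∈ₛ T x → v ∈ₛ T x′ → ¬ HAdj H u v
  branches-apart {x} {x′} {u} {v} x≢x′ u∈ v∈ adj with edges u v adj
  ... | inj₁ (a , u∈a , v∈a) with a ≟ᶠ x
  ...   | yes refl = TT-disj x x′ x≢x′ v v∈a v∈
  ...   | no a≢x   = TT-disj a x a≢x u u∈a u∈
  branches-apart {x} {x′} {u} {v} x≢x′ u∈ v∈ adj | inj₂ (y , z , y<z , u∈p , v∈p) =
    PathOf.ends-apart y<z (proj₂ (TP-disj y z y<z x u u∈ u∈p)) (proj₂ (TP-disj y z y<z x′ v v∈ v∈p)) u∈p v∈p adj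

  -- An induction principle for expansions: a property of vertex lists preserved by the three moves
  -- passes from the empty list to one containing all vertices. The move `connect` fills a segment
  -- with `suc k` vertices from each side.
  module Construction (Conf : List (Fin m) → Set)
    (add-root  : ∀ {Dom} → Conf Dom → ∀ y → root y ∉ₗ Dom → (∀ {g} → g ∈ₗ Dom → ¬ HAdj H g (root y)) → Conf (root y ∷ Dom))
    (add-child : ∀ {Dom h h′} → Conf Dom → h ∈ₗ Dom → h′ ∉ₗ Dom → HAdj H h h′ →
                 (∀ {g} → g ∈ₗ Dom → HAdj H g h′ → g ≡ h) → Conf (h′ ∷ Dom))
    (connect   : ∀ {q Dom} → IsSegment H q (suc (suc k + suc k)) Dom → Conf Dom →
                 Conf (upto (λ j → q (suc (suc k + suc k) ∸ j)) (suc k) (upto q (suc k) Dom))) where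

    -- Paths without repetition, since they are to be closed up to a `Cycle`.
    SimplePath : List (Fin m) → Fin m → Fin m → Set
    SimplePath S u v = ∃ λ ws → Unique (u ∷ ws) × All (_∈ₗ S) (u ∷ ws) × Linked (HAdj H) (u ∷ ws) × last (u ∷ ws) ≡ just v

    Connected : List (Fin m) → Set
    Connected S = ∀ {u v} → u ∈ₗ S → v ∈ₗ S → SimplePath S u v

    connected-∷ : ∀ {S a b} → Connected S → a ∈ₗ S → b ∉ₗ S → HAdj H a b → Connected (b ∷ S)
    connected-∷ conn a∈ b∉ ab (here refl) (here refl) = [] , [] ∷ [] , here refl ∷ [] , [-] , refl
    connected-∷ conn a∈ b∉ ab (here refl) (there v∈) with conn a∈ v∈
    ... | ws , u , ins , l , e = _ ∷ ws , All.tabulate (λ { w∈ refl → b∉ (All.lookup ins w∈) }) ∷ u ,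
      here refl ∷ All.map there ins , HAdj-sym ab ∷ l , e
    connected-∷ conn a∈ b∉ ab (there u∈) (here refl) with conn u∈ a∈
    ... | ws , u , ins , l , e = ws ∷ʳ _ , Unique-∷ʳ u (λ b∈ → b∉ (All.lookup ins b∈)) ,
      Allₚ.++⁺ (All.map there ins) (here refl ∷ []) , Linked-∷ʳ l e ab , last-∷ʳ (_ ∷ ws) _
    connected-∷ conn a∈ b∉ ab (there u∈) (there v∈) with conn u∈ v∈
    ... | ws , u , ins , l , e = ws , u , All.map there ins , l , e

    -- A second neighbour `g` of `b` would close a simple path from `a` to `g` inside `S` to a cycle
    -- through `b` in the tree `T x`.
    unique-neighbour : ∀ {S a b x} → Connected S → (∀ {g} → g ∈ₗ S → g ∈ₛ T x) → a ∈ₗ S → b ∉ₗ S → b ∈ₛ T x → HAdj H a b →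
      ∀ {g} → g ∈ₗ S → HAdj H g b → g ≡ a
    unique-neighbour {S} {a} {b} {x} conn S⊆ a∈ b∉ b∈T ab {g} g∈ gb with g ≟ᶠ a
    ... | yes eq = eq
    ... | no g≢a with conn a∈ g∈
    ...   | [] , _ , _ , _ , refl = contradiction refl g≢a
    ...   | w ∷ ws , u , ins , l , e = contradiction
      (b , g , a ∷ w ∷ ws , s≤s (s≤s z≤n) , All.tabulate (λ { w∈ refl → b∉ (All.lookup ins w∈) }) ∷ u ,
        b∈T ∷ All.map S⊆ ins , HAdj-sym ab ∷ l , e , gb)
      (proj₂ (proj₂ (T-tree x)))

    module _ (x : Fin D) {Dom₀ : List (Fin m)} (elsewhere : ∀ {g} → g ∈ₗ Dom₀ → ∃ λ x′ → x ≢ x′ × g ∈ₛ T x′) where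

      outside : ∀ {b} → b ∈ₛ T x → b ∉ₗ Dom₀
      outside b∈T b∈ with elsewhere b∈
      ... | x′ , x≢x′ , b∈′ = TT-disj x x′ x≢x′ _ b∈T b∈′

      apart : ∀ {b g} → b ∈ₛ T x → g ∈ₗ Dom₀ → ¬ HAdj H g b
      apart b∈T g∈ gb with elsewhere g∈
      ... | x′ , x≢x′ , g∈′ = branches-apart x≢x′ b∈T g∈′ (HAdj-sym gb)

      Missing? : ∀ S → Decidable (λ h → h ∈ₛ T x × h ∉ₗ S)
      Missing? S h = (h ∈ₛ? T x) ×-dec ¬? (h ∈? S)

      Goal : Set
      Goal = ∃ λ S → Conf (S ++ Dom₀) × (∀ {g} → g ∈ₗ S → g ∈ₛ T x) × (∀ {g} → g ∈ₛ T x → g ∈ₗ S)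

      -- A walk in the tree from a placed vertex to a missing one leaves `S` along some edge, whose
      -- far end is added next. The number `f` bounds the vertices still missing.
      spread : ∀ f S → # (Missing? S) ≤ f → Conf (S ++ Dom₀) →
        (∀ {g} → g ∈ₗ S → g ∈ₛ T x) → Connected S → ∀ {r} → r ∈ₗ S → Goal
      spread f S few conf S⊆ conn {r} r∈ with any? (Missing? S)
      ... | no none = S , conf , S⊆ , λ {g} g∈T → [ (λ p → p) , (λ g∉ → contradiction (g , g∈T , g∉) none) ]′ (toSum (g ∈? S))
      ... | yes (v , v∈T , v∉) with proj₁ (proj₂ (T-tree x)) r v (S⊆ r∈) v∈T
      ...   | ws , ins , l , e with first-exit (_∈? S) ws r∈ v∉ ins l e
      ...     | a , b , a∈ , b∉ , b∈T , ab = next f few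
        where
        only : ∀ {g} → g ∈ₗ S ++ Dom₀ → HAdj H g b → g ≡ a
        only g∈ gb with ∈-++⁻ S g∈
        ... | inj₁ p = unique-neighbour conn S⊆ a∈ b∉ b∈T ab p gb
        ... | inj₂ p = contradiction gb (apart b∈T p)
        b∉′ : b ∉ₗ S ++ Dom₀
        b∉′ p = [ b∉ , outside b∈T ]′ (∈-++⁻ S p)
        fewer : # (Missing? (b ∷ S)) < # (Missing? S)
        fewer = #-strict (Missing? (b ∷ S)) (Missing? S) (λ (h∈ , h∉) → h∈ , λ p → h∉ (there p))
                         (b∈T , b∉) (λ (_ , b∉b) → b∉b (here refl))
        next : ∀ f → # (Missing? S) ≤ f → Goal
        next zero    none = contradiction (≤-trans fewer none) λ ()
        next (suc f) few  = spread f (b ∷ S) (≤-pred (≤-trans fewer few)) (add-child conf (∈-++⁺ˡ a∈) b∉′ ab only)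
          (λ { (here refl) → b∈T ; (there p) → S⊆ p }) (connected-∷ conn a∈ b∉ ab) (here refl)

      branch : Conf Dom₀ → Goal
      branch conf = spread _ (root x ∷ []) ≤-refl (add-root conf x (outside r∈T) (apart r∈T))
        (λ { (here refl) → r∈T }) (λ { (here refl) (here refl) → [] , [] ∷ [] , here refl ∷ [] , [-] , refl }) (here refl)
        where
        r∈T : root x ∈ₛ T x
        r∈T = proj₂ (proj₁ (T-tree x))

    branches : Conf [] → ∀ xs → Unique xs → ∃ λ Dom → Conf Dom × (∀ {g} → g ∈ₗ Dom → ∃ λ x → x ∈ₗ xs × g ∈ₛ T x)
      × (∀ {x g} → x ∈ₗ xs → g ∈ₛ T x → g ∈ₗ Dom)
    branches conf [] _ = [] , conf , (λ ()) , λ ()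
    branches conf (x ∷ xs) (x∉ ∷ u) with branches conf xs u
    ... | Dom , conf′ , sound , complete
      with branch x (λ g∈ → let (x′ , x′∈ , g∈T) = sound g∈ in x′ , All.lookup x∉ x′∈ , g∈T) conf′
    ...   | S , conf″ , S⊆ , ⊆S = S ++ Dom , conf″ ,
      (λ g∈ → [ (λ p → x , here refl , S⊆ p) , (λ p → let (x′ , x′∈ , g∈T) = sound p in x′ , there x′∈ , g∈T) ]′ (∈-++⁻ S g∈)) ,
      λ { (here refl) g∈T → ∈-++⁺ˡ (⊆S g∈T) ; (there x∈) g∈T → ∈-++⁺ʳ S (complete x∈ g∈T) }

    h L₀ : ℕ
    h  = suc k
    L₀ = suc (h + h)

    module _ {y z : Fin D} (y<z : y <ᶠ z) {Dom : List (Fin m)} (T⊆ : ∀ {x g} → g ∈ₛ T x → g ∈ₗ Dom) where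
      open PathOf y<z

      module _ (interior∉ : ∀ {j} → 1 ≤ j → j < L → q j ∉ₗ Dom) where

        seg : IsSegment H q L Dom
        seg = record
          { start∈      = T⊆ start∈T
          ; finish∈     = T⊆ finish∈T
          ; interior∉   = interior∉
          ; q-injective = q-injective
          ; link        = link
          ; nbrs        = interior-nbrs y<z
          }
        open Segment seg

        lead : ℕ
        lead = L ∸ L₀

        lead+L₀ : lead + L₀ ≡ L
        lead+L₀ = m∸n+n≡m (≤-trans (≤-reflexive (segment-length k)) (long y z y<z))

        within₀ : ∀ {i} → i ≤ L₀ → lead + i ≤ L
        within₀ i≤ = ≤-trans (+-monoʳ-≤ lead i≤) (≤-reflexive lead+L₀)

        walk : ∀ j → j ≤ lead → Conf Dom → Conf (upto q j Dom)
        walk zero    _  conf = conf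
        walk (suc i) i< conf = add-child (walk i (<⇒≤ i<) conf) (∈-upto⁺ʳ q i (T⊆ start∈T) ≤-refl)
          (advance-new (<-trans (n<1+n _) i+2<L)) (link (<-trans (n<1+n _) (<-trans (n<1+n _) i+2<L))) (advance-only i+2<L)
          where
          -- At least two edges remain after the lead, so `q (suc (suc i))` is still short of the
          -- finish, as `advance-only` requires.
          i+2<L : suc (suc i) < L
          i+2<L = ≤-trans (≤-reflexive (+-comm 2 (suc i))) (≤-trans (+-mono-≤ i< (s≤s (s≤s z≤n))) (≤-reflexive lead+L₀))

        tail : ℕ → Fin m
        tail i = q (lead + i)

        tail-seg : IsSegment H tail L₀ (upto q lead Dom)
        tail-seg = record
          { start∈      = subst (λ a → q a ∈ₗ upto q lead Dom) (sym (+-identityʳ lead)) (∈-upto⁺ʳ q lead (T⊆ start∈T) ≤-refl)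
          ; finish∈     = subst (λ a → q a ∈ₗ upto q lead Dom) (sym lead+L₀) (∈-upto⁺ˡ q lead (T⊆ finish∈T))
          ; interior∉   = tail∉
          ; q-injective = λ i≤ j≤ eq → +-cancelˡ-≡ lead _ _ (q-injective (within₀ i≤) (within₀ j≤) eq)
          ; link        = λ {j} j< → subst (λ a → HAdj H (tail j) (q a)) (sym (+-suc lead j)) (link (strict j<))
          ; nbrs        = tail-nbrs
          }
          where
          strict : ∀ {j} → j < L₀ → lead + j < L
          strict {j} j< = ≤-trans (≤-reflexive (sym (+-suc lead j))) (within₀ j<)
          tail∉ : ∀ {j} → 1 ≤ j → j < L₀ → tail j ∉ₗ upto q lead Dom
          tail∉ {j} 1≤j j< p = [ (λ le → <-irrefl refl (<-≤-trans (m<m+n lead 1≤j) le)) , (λ eq → <-irrefl eq (strict j<)) ]′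
            (locate-upto (within₀ (<⇒≤ j<)) (≤-trans (m≤m+n lead L₀) (≤-reflexive lead+L₀)) p)
          tail-nbrs : ∀ {j g} → 1 ≤ j → j < L₀ → HAdj H g (tail j) → ∃ λ i → i ≤ L₀ × g ≡ tail i × (i ≡ suc j ⊎ j ≡ suc i)
          tail-nbrs {suc j} 1≤j j< adj with interior-nbrs y<z (≤-trans 1≤j (m≤n+m (suc j) lead)) (strict j<) adj
          ... | i , _ , refl , inj₁ eq = suc (suc j) , j< , cong q (trans eq (sym (+-suc lead (suc j)))) , inj₁ refl
          ... | i , _ , refl , inj₂ eq = j , <⇒≤ (<⇒≤ j<) , cong q (suc-injective (trans (sym eq) (+-suc lead j))) , inj₂ refl

        reversed : ℕ → Fin m
        reversed j = tail (L₀ ∸ j)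

        Dom′ : List (Fin m)
        Dom′ = upto reversed h (upto tail h (upto q lead Dom))

        Dom⊆Dom′ : ∀ {g} → g ∈ₗ Dom → g ∈ₗ Dom′
        Dom⊆Dom′ g∈ = ∈-upto⁺ˡ reversed h (∈-upto⁺ˡ tail h (∈-upto⁺ˡ q lead g∈))

        Dom′-sound : ∀ {g} → g ∈ₗ Dom′ → g ∈ₗ Dom ⊎ g ∈ₗ P y z
        Dom′-sound g∈ with ∈-upto⁻ reversed h g∈
        ... | inj₂ (j , _ , refl) = inj₂ (q-∈ (within₀ (m∸n≤m L₀ j)))
        ... | inj₁ g∈₁ with ∈-upto⁻ tail h g∈₁
        ...   | inj₂ (j , j≤ , refl) = inj₂ (q-∈ (within₀ (≤-trans j≤ (m≤n⇒m≤1+n (m≤m+n h h)))))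
        ...   | inj₁ g∈₂ with ∈-upto⁻ q lead g∈₂
        ...     | inj₂ (j , j≤ , refl) = inj₂ (q-∈ (≤-trans j≤ (m∸n≤m L L₀)))
        ...     | inj₁ g∈₃ = inj₁ g∈₃

        tail-∈ : ∀ {i} → i ≤ L₀ → tail i ∈ₗ Dom′
        tail-∈ {i} i≤ with i ≤? h
        ... | yes i≤h = ∈-upto⁺ˡ reversed h (∈-upto⁺ʳ tail h (IsSegment.start∈ tail-seg) i≤h)
        ... | no i≰h  = subst (λ a → tail a ∈ₗ Dom′) (m∸[m∸n]≡n i≤)
          (∈-upto⁺ʳ reversed h (∈-upto⁺ˡ tail h (IsSegment.finish∈ tail-seg))
            (≤-trans (∸-monoʳ-≤ L₀ (≰⇒> i≰h)) (≤-reflexive (m+n∸m≡n h h))))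

        P⊆Dom′ : ∀ {g} → g ∈ₗ P y z → g ∈ₗ Dom′
        P⊆Dom′ g∈ with ∈-q g∈
        ... | i , i≤ , refl with ≤-total i lead
        ...   | inj₁ i≤lead = ∈-upto⁺ˡ reversed h (∈-upto⁺ˡ tail h (∈-upto⁺ʳ q lead (T⊆ start∈T) i≤lead))
        ...   | inj₂ lead≤i = subst (λ a → q a ∈ₗ Dom′) (m+[n∸m]≡n lead≤i)
          (tail-∈ (+-cancelˡ-≤ lead _ _ (≤-trans (≤-reflexive (m+[n∸m]≡n lead≤i)) (≤-trans i≤ (≤-reflexive (sym lead+L₀))))))

        add-path : Conf Dom → Conf Dom′
        add-path conf = connect tail-seg (walk lead ≤-refl conf)

    paths : ∀ {Dom₀} → Conf Dom₀ → (∀ {x g} → g ∈ₛ T x → g ∈ₗ Dom₀) → (∀ {g} → g ∈ₗ Dom₀ → ∃ λ x → g ∈ₛ T x) →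
      ∀ ps → Unique ps → (∀ {y z} → (y , z) ∈ₗ ps → y <ᶠ z) →
      ∃ λ Dom → Conf Dom × (∀ {x g} → g ∈ₛ T x → g ∈ₗ Dom)
        × (∀ {g} → g ∈ₗ Dom → (∃ λ x → g ∈ₛ T x) ⊎ (∃₂ λ y z → (y , z) ∈ₗ ps × g ∈ₗ P y z))
        × (∀ {y z g} → (y , z) ∈ₗ ps → g ∈ₗ P y z → g ∈ₗ Dom)
    paths conf T⊆ ⊆T [] _ _ = _ , conf , T⊆ , (λ g∈ → inj₁ (⊆T g∈)) , λ ()
    paths conf T⊆ ⊆T ((y , z) ∷ ps) (yz∉ ∷ u) ordered with paths conf T⊆ ⊆T ps u (λ p → ordered (there p))
    ... | Dom , conf′ , T⊆Dom , sound , complete = Dom′ y<z T⊆Dom interior∉ , add-path y<z T⊆Dom interior∉ conf′ ,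
      (λ g∈ → Dom⊆Dom′ y<z T⊆Dom interior∉ (T⊆Dom g∈)) , sound′ ,
      λ { (here refl) g∈ → P⊆Dom′ y<z T⊆Dom interior∉ g∈ ; (there p) g∈ → Dom⊆Dom′ y<z T⊆Dom interior∉ (complete p g∈) }
      where
      y<z : y <ᶠ z
      y<z = ordered (here refl)
      open PathOf y<z using (q; L; interior∉T)
      interior∉ : ∀ {j} → 1 ≤ j → j < L → q j ∉ₗ Dom
      interior∉ 1≤j j<L qj∈ with sound qj∈
      ... | inj₁ (_ , qj∈T) = interior∉T 1≤j j<L qj∈T
      ... | inj₂ (y′ , z′ , p , qj∈P) with interior-private y<z (ordered (there p)) 1≤j j<L qj∈P
      ...   | refl , refl = All.lookup yz∉ p refl
      sound′ : ∀ {g} → g ∈ₗ Dom′ y<z T⊆Dom interior∉ →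
        (∃ λ x → g ∈ₛ T x) ⊎ (∃₂ λ y′ z′ → (y′ , z′) ∈ₗ (y , z) ∷ ps × g ∈ₗ P y′ z′)
      sound′ g∈ with Dom′-sound y<z T⊆Dom interior∉ g∈
      ... | inj₂ g∈P = inj₂ (y , z , here refl , g∈P)
      ... | inj₁ g∈′ with sound g∈′
      ...   | inj₁ p = inj₁ p
      ...   | inj₂ (y′ , z′ , p , g∈P) = inj₂ (y′ , z′ , there p , g∈P)

    pairs : List (Fin D × Fin D)
    pairs = filter (λ (y , z) → y <ᶠ? z) (cartesianProduct (allFin D) (allFin D))

    assemble : Conf [] → ∃ λ Dom → Conf Dom × (∀ g → g ∈ₗ Dom)
    assemble conf with branches conf (allFin D) (Uniqueₚ.allFin⁺ D)
    ... | Dom₁ , conf₁ , sound₁ , complete₁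
      with paths conf₁ (λ {x} g∈ → complete₁ (∈-allFin x) g∈) (λ g∈ → let (x , _ , g∈T) = sound₁ g∈ in x , g∈T) pairs
             (Uniqueₚ.filter⁺ (λ (y , z) → y <ᶠ? z) (Uniqueₚ.cartesianProduct⁺ (Uniqueₚ.allFin⁺ D) (Uniqueₚ.allFin⁺ D)))
             (λ p → proj₂ (∈-filter⁻ (λ (y , z) → y <ᶠ? z) {xs = cartesianProduct (allFin D) (allFin D)} p))
    ...   | Dom₂ , conf₂ , T⊆ , _ , complete₂ = Dom₂ , conf₂ , all
      where
      all : ∀ g → g ∈ₗ Dom₂
      all g with cover g
      ... | inj₁ (_ , g∈T) = T⊆ g∈T
      ... | inj₂ (y , z , y<z , g∈P) = complete₂ (∈-filter⁺ (λ (y , z) → y <ᶠ? z)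
        (∈-cartesianProduct⁺ (∈-allFin y) (∈-allFin z)) y<z) g∈P

-- Embedding the expansion

module Embedding
  {N n t m : ℕ} (R : Fin N → Fin n → Set) (R? : ∀ x w → Dec (R x w)) (s D : ℕ)
  (code : Fin n → Fin t → Fin N) (code-injective : ∀ {u v i j} → code u i ≡ code v j → u ≡ v)
  (code-injectiveʳ : ∀ {u v i j} → code u i ≡ code v j → i ≡ j)
  (1≤s : 1 ≤ s) (joined : Expander.Joined R R? s D)
  (source : Fin N) (code≢source : ∀ {v i} → code v i ≢ source)
  (𝒢 : Fin t → Graph n) (H : ColGraph m t) (mon : MonDegAtMost H D)
  (E : ExpansionOfK H D) (σ₀ : Fin n → Slot N)
  (σ₀-unowned : ∀ {w x} → σ₀ w ≢ owned x)
  (R-adj : ∀ {v i w} → σ₀ v ≢ dead → R (code v i) w → Graph.Adj (𝒢 i) v w)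
  where

  open Expander R R? s D
  open Growth R R? s D code code-injective 1≤s joined hiding (valid)
  open ColGraph H using (col)

  root : Fin D → Fin m
  root = branch-root E
  open import Data.List.Membership.DecPropositional (_≟ᶠ_ {m}) using (_∈?_)

  -- Ownership mirrors `H`: the common parent owns branch roots, and `code (φ g) i` owns images of
  -- neighbours of `g` in colour `i`. This turns degree bounds in `H` into bounds on child counts.
  Parent : (Fin m → Fin n) → List (Fin m) → Fin N → Fin m → Set
  Parent φ Dom x h = (x ≡ source × ∃ λ y → h ≡ root y)
                   ⊎ (∃₂ λ g i → g ∈ₗ Dom × x ≡ code (φ g) i × col g h ≡ just i)

  record Emb (σ : State) (φ : Fin m → Fin n) (Dom : List (Fin m)) : Set where
    field
      valid     : Valid σ
      base≼     : σ₀ ≼ σ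
      used      : ∀ {w} → Used σ w → Used σ₀ w ⊎ ∃ λ h → h ∈ₗ Dom × φ h ≡ w
      injective : ∀ {g h} → g ∈ₗ Dom → h ∈ₗ Dom → φ g ≡ φ h → g ≡ h
      placed    : ∀ {h} → h ∈ₗ Dom → ∃ λ x → σ (φ h) ≡ owned x
      adj       : ∀ {g h i} → g ∈ₗ Dom → h ∈ₗ Dom → col g h ≡ just i → Graph.Adj (𝒢 i) (φ g) (φ h)
      parent    : ∀ {w x} → σ w ≡ owned x → ∃ λ h → h ∈ₗ Dom × φ h ≡ w × Parent φ Dom x h

  Conf : List (Fin m) → Set
  Conf Dom = ∃₂ λ σ φ → Emb σ φ Dom × Extendable σ

  conf-[] : (Fin m → Fin n) → Extendable σ₀ → Conf []
  conf-[] φ ext = σ₀ , φ , record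
    { valid     = λ _ _ o → contradiction o σ₀-unowned
    ; base≼     = ≼-refl
    ; used      = inj₁
    ; injective = λ ()
    ; placed    = λ ()
    ; adj       = λ ()
    ; parent    = λ o → contradiction o σ₀-unowned
    } , ext

  module _ {σ φ Dom} (e : Emb σ φ Dom) where
    open Emb e

    placed-used : ∀ {h} → h ∈ₗ Dom → Used σ (φ h)
    placed-used h∈ = owned⇒used {σ} (proj₂ (placed h∈))

    not-dead : ∀ {h} → h ∈ₗ Dom → σ₀ (φ h) ≢ dead
    not-dead {h} h∈ d with base≼ (φ h) | placed h∈
    ... | inj₁ f | _     = case-free (trans (sym d) f)
      where
      case-free : dead {N} ≡ free → ⊥
      case-free ()
    ... | inj₂ o | x , p = case-owned (trans (sym d) (trans o p))
      where
      case-owned : dead {N} ≡ owned x → ⊥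
      case-owned ()

    emb-closed : Closed σ
    emb-closed o with parent o
    ... | _ , _ , _ , inj₁ (eq , _) = contradiction eq code≢source
    ... | _ , _ , _ , inj₂ (g , _ , g∈ , eq , _) = subst (Used σ) (sym (code-injective eq)) (placed-used g∈)

    emb-good : Extendable σ → Good σ
    emb-good ext = good valid ext emb-closed

    -- The children are images of embedded colour-`i` neighbours of `h`. As `h′` is such a neighbour
    -- not yet embedded, they are fewer than the at most `D` neighbours of that colour.
    children<D : ∀ {h h′ i} → h ∈ₗ Dom → h′ ∉ₗ Dom → col h h′ ≡ just i → children σ (code (φ h) i) < D
    children<D {h} {h′} {i} h∈ h′∉ c = ≤-trans (s≤s (#-image (λ w → owned? (code (φ h) i) (σ w)) nbr∈? φ child))
      (≤-trans (#-strict nbr∈? nbr? proj₂ c (λ p → h′∉ (proj₁ p))) (mon i h))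
      where
      nbr? : Decidable (λ g → col h g ≡ just i)
      nbr? g = ≡-dec _≟ᶠ_ (col h g) (just i)
      nbr∈? : Decidable (λ g → g ∈ₗ Dom × col h g ≡ just i)
      nbr∈? g = (g ∈? Dom) ×-dec nbr? g
      child : ∀ {w} → σ w ≡ owned (code (φ h) i) → ∃ λ g → (g ∈ₗ Dom × col h g ≡ just i) × φ g ≡ w
      child o with parent o
      ... | _ , _ , _ , inj₁ (eq , _) = contradiction eq code≢source
      ... | g , g∈ , eq , inj₂ (h₁ , j , h₁∈ , eq₁ , c₁) = g ,
        (g∈ , trans (cong (λ a → col a g) h≡) (trans c₁ (cong just (sym (code-injectiveʳ eq₁))))) , eq
        where
        h≡ : h ≡ h₁
        h≡ = injective h∈ h₁∈ (code-injective eq₁)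

    -- Children of the common parent are images of embedded roots, and `root y` is missing among the
    -- `D` indices.
    roots<D : ∀ y → root y ∉ₗ Dom → children σ source < D
    roots<D y y∉ = ≤-trans (s≤s (#-image (λ w → owned? source (σ w)) root∈? (λ z → φ (root z)) child))
      (≤-trans (#-strict root∈? U? (λ _ → tt) {v = y} tt y∉) (≤-reflexive #-U))
      where
      root∈? : Decidable (λ z → root z ∈ₗ Dom)
      root∈? z = root z ∈? Dom
      child : ∀ {w} → σ w ≡ owned source → ∃ λ z → root z ∈ₗ Dom × φ (root z) ≡ w
      child o with parent o
      ... | h , h∈ , eq , inj₁ (_ , z , refl) = z , h∈ , eq
      ... | _ , _ , _ , inj₂ (_ , _ , _ , eq , _) = contradiction (sym eq) code≢source

    #-used : # (Used? σ) ≤ # (Used? σ₀) + m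
    #-used = ≤-trans (#-cover (Used? σ) (Used? σ₀) image? split)
      (+-monoʳ-≤ (# (Used? σ₀)) (≤-trans (#-image image? (U? {A = Fin m}) φ (λ { (h , eq) → h , tt , eq })) (#-≤ U?)))
      where
      image? : Decidable (λ w → ∃ λ h → φ h ≡ w)
      image? w = any? λ h → φ h ≟ᶠ w
      split : ∀ {w} → Used σ w → Used σ₀ w ⊎ ∃ λ h → φ h ≡ w
      split u with used u
      ... | inj₁ p = inj₁ p
      ... | inj₂ (h , _ , eq) = inj₂ (h , eq)

  abstract
    set : (Fin m → Fin n) → Fin m → Fin n → Fin m → Fin n
    set φ h w g with g ≟ᶠ h
    ... | yes _ = w
    ... | no _  = φ g

    set-same : ∀ φ h w → set φ h w h ≡ w
    set-same φ h w with h ≟ᶠ h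
    ... | yes _  = refl
    ... | no h≢h = contradiction refl h≢h

    set-other : ∀ φ {h} w {g} → g ≢ h → set φ h w g ≡ φ g
    set-other φ {h} w {g} g≢h with g ≟ᶠ h
    ... | yes g≡h = contradiction g≡h g≢h
    ... | no _    = refl

  set-∈ : ∀ φ {h w g} {Dom : List (Fin m)} → h ∉ₗ Dom → g ∈ₗ Dom → set φ h w g ≡ φ g
  set-∈ φ {w = w} h∉ g∈ = set-other φ w λ { refl → h∉ g∈ }

  place : ∀ {σ φ Dom h w x} → Emb σ φ Dom → h ∉ₗ Dom → σ w ≡ free → R x w → Parent φ Dom x h →
    (∀ {g i} → g ∈ₗ Dom → col g h ≡ just i → Graph.Adj (𝒢 i) (φ g) w) →
    Emb (assign σ w x) (set φ h w) (h ∷ Dom)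
  place {σ} {φ} {Dom} {h} {w} {x} e h∉ f r par nbr = record
    { valid     = assign-valid valid r
    ; base≼     = ≼-trans base≼ below
    ; used      = used′
    ; injective = injective′
    ; placed    = placed′
    ; adj       = adj′
    ; parent    = parent′
    }
    where
    open Emb e
    σ′ = assign σ w x
    φ′ = set φ h w
    below : σ ≼ σ′
    below = assign-≼ f
    here′ : φ′ h ≡ w
    here′ = set-same φ h w
    old : ∀ {g} → g ∈ₗ Dom → φ′ g ≡ φ g
    old = set-∈ φ h∉
    w≢ : ∀ {g} → g ∈ₗ Dom → φ g ≢ w
    w≢ g∈ eq = placed-used e g∈ (trans (cong σ eq) f)
    used′ : ∀ {v} → Used σ′ v → Used σ₀ v ⊎ ∃ λ g → g ∈ₗ h ∷ Dom × φ′ g ≡ v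
    used′ {v} u with v ≟ᶠ w
    ... | yes refl = inj₂ (h , here refl , here′)
    ... | no v≢w with used (λ fv → u (trans (assign-other σ w x v≢w) fv))
    ...   | inj₁ p = inj₁ p
    ...   | inj₂ (g , g∈ , eq) = inj₂ (g , there g∈ , trans (old g∈) eq)
    injective′ : ∀ {g g′} → g ∈ₗ h ∷ Dom → g′ ∈ₗ h ∷ Dom → φ′ g ≡ φ′ g′ → g ≡ g′
    injective′ (here refl) (here refl) eq = refl
    injective′ (here refl) (there p)   eq = contradiction (trans (sym (old p)) (trans (sym eq) here′)) (w≢ p)
    injective′ (there p)   (here refl) eq = contradiction (trans (sym (old p)) (trans eq here′)) (w≢ p)
    injective′ (there p)   (there q)   eq = injective p q (trans (sym (old p)) (trans eq (old q)))
    placed′ : ∀ {g} → g ∈ₗ h ∷ Dom → ∃ λ y → σ′ (φ′ g) ≡ owned y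
    placed′ (here refl) = x , trans (cong σ′ here′) (assign-same σ w x)
    placed′ (there p)   = proj₁ (placed p) , trans (cong σ′ (old p)) (trans (assign-other σ w x (w≢ p)) (proj₂ (placed p)))
    adj′ : ∀ {g g′ i} → g ∈ₗ h ∷ Dom → g′ ∈ₗ h ∷ Dom → col g g′ ≡ just i → Graph.Adj (𝒢 i) (φ′ g) (φ′ g′)
    adj′ (here refl) (here refl) c with trans (sym c) (ColGraph.irrefl H h)
    ... | ()
    adj′ {i = i} (here refl) (there p) c = subst₂ (Graph.Adj (𝒢 i)) (sym here′) (sym (old p))
      (Graph.sym (𝒢 i) (nbr p (trans (ColGraph.sym H _ h) c)))
    adj′ {i = i} (there p) (here refl) c = subst₂ (Graph.Adj (𝒢 i)) (sym (old p)) (sym here′) (nbr p c)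
    adj′ {i = i} (there p) (there q)   c = subst₂ (Graph.Adj (𝒢 i)) (sym (old p)) (sym (old q)) (adj p q c)
    lift : ∀ {y g} → Parent φ Dom y g → Parent φ′ (h ∷ Dom) y g
    lift (inj₁ p) = inj₁ p
    lift (inj₂ (g , i , g∈ , eq , c)) = inj₂ (g , i , there g∈ , trans eq (cong (λ a → code a i) (sym (old g∈))) , c)
    parent′ : ∀ {v y} → σ′ v ≡ owned y → ∃ λ g → g ∈ₗ h ∷ Dom × φ′ g ≡ v × Parent φ′ (h ∷ Dom) y g
    parent′ {v} o with assign-owned σ w x {v} o
    ... | inj₁ (refl , refl) = h , here refl , here′ , lift par
    ... | inj₂ (_ , o′) with parent o′
    ...   | g , g∈ , eq , p = g , there g∈ , trans (old g∈) eq , lift p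

  used-bound : ∀ {σ φ Dom} → Emb σ φ Dom → # (Used? σ) + s + D * (2 * s) ≤ m + (# (Used? σ₀) + s + D * (2 * s))
  used-bound {σ} e = begin
    # (Used? σ) + s + D * (2 * s)           ≤⟨ +-monoˡ-≤ _ (+-monoˡ-≤ s (#-used e)) ⟩
    # (Used? σ₀) + m + s + D * (2 * s)      ≡⟨ cong (λ a → a + s + D * (2 * s)) (+-comm (# (Used? σ₀)) m) ⟩
    m + # (Used? σ₀) + s + D * (2 * s)      ≡⟨ cong (_+ D * (2 * s)) (+-assoc m (# (Used? σ₀)) s) ⟩
    m + (# (Used? σ₀) + s) + D * (2 * s)    ≡⟨ +-assoc m _ _ ⟩
    m + (# (Used? σ₀) + s + D * (2 * s))    ∎
    where open ≤-Reasoning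

  module _ (roomy : m + (# (Used? σ₀) + s + D * (2 * s)) ≤ n) where

    room₁ : ∀ {σ φ Dom} → Emb σ φ Dom → # (Used? σ) + s + D * (2 * s) ≤ n
    room₁ e = ≤-trans (used-bound e) roomy

    add-root : ∀ {Dom} → Conf Dom → ∀ y → root y ∉ₗ Dom → (∀ {g} → g ∈ₗ Dom → ¬ HAdj H g (root y)) → Conf (root y ∷ Dom)
    add-root (σ , φ , e , ext) y y∉ iso with extend 1≤s joined {σ} ext (room₁ e) source (roots<D e y y∉)
    ... | w , f , r , ext′ = assign σ w source , set φ (root y) w ,
      place e y∉ f r (inj₁ (refl , y , refl)) (λ g∈ c → contradiction (_ , c) (iso g∈)) , ext′

    add-child : ∀ {Dom h h′ i} → Conf Dom → h ∈ₗ Dom → h′ ∉ₗ Dom → col h h′ ≡ just i →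
      (∀ {g} → g ∈ₗ Dom → HAdj H g h′ → g ≡ h) → Conf (h′ ∷ Dom)
    add-child {Dom} {h} {h′} {i} (σ , φ , e , ext) h∈ h′∉ c only
      with extend 1≤s joined {σ} ext (room₁ e) (code (φ h) i) (children<D e h∈ h′∉ c)
    ... | w , f , r , ext′ = assign σ w (code (φ h) i) , set φ h′ w ,
      place e h′∉ f r (inj₂ (h , i , h∈ , refl , c)) nbr , ext′
      where
      nbr : ∀ {g j} → g ∈ₗ Dom → col g h′ ≡ just j → Graph.Adj (𝒢 j) (φ g) w
      nbr g∈ c′ with only g∈ (_ , c′)
      ... | refl with trans (sym c) c′
      -- The image of an embedded vertex is not dead, so the edge of `R` found by `extend` is a
      -- genuine edge of the family.
      ...   | refl = R-adj (not-dead e h∈) r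

  -- Replaying one tree path on top of an embedding

  record Replay (φ : Fin m → Fin n) (Dom : List (Fin m)) (q : ℕ → Fin m) (τ : State) (j : ℕ) (l : Fin n) : Set where
    field
      σ′    : State
      φ′    : Fin m → Fin n
      emb   : Emb σ′ φ′ (upto q j Dom)
      below : σ′ ≼ τ
      end   : φ′ (q j) ≡ l
      keep  : ∀ {g} → g ∈ₗ Dom → φ′ g ≡ φ g

  module _ {τ₀ : State} {v : Fin n} {c : ℕ → Fin t} (q : ℕ → Fin m) {σ φ Dom}
           (e : Emb σ φ Dom) (p₀ : σ ≼ τ₀) (q0∈ : q 0 ∈ₗ Dom) (q0↦ : φ (q 0) ≡ v) where

    -- The alternative in the last premise admits one further embedded neighbour besides `q j`,
    -- provided its adjacency to `w` is known already. The second tree path ends that way, at the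
    -- middle edge.
    replay-snoc : ∀ {j τ τ′ l w} → Replay φ Dom q τ j l → τ ≼ τ′ → τ w ≡ free →
      τ′ w ≡ owned (code l (c j)) → R (code l (c j)) w → q (suc j) ∉ₗ upto q j Dom → col (q j) (q (suc j)) ≡ just (c j) →
      (∀ {φ′ g i} → (∀ {h} → h ∈ₗ Dom → φ′ h ≡ φ h) → g ∈ₗ upto q j Dom →
        col g (q (suc j)) ≡ just i → g ≡ q j ⊎ Graph.Adj (𝒢 i) (φ′ g) w) →
      Replay φ Dom q τ′ (suc j) w
    replay-snoc {j} {τ} {τ′} {l} {w} rp τ≼τ′ f o r new c≡ nbr = record
      { σ′    = assign σ′ w x
      ; φ′    = set φ′ (q (suc j)) w
      ; emb   = place emb new f′ r (inj₂ (q j , c j , qj∈ , cong (λ a → code a (c j)) (sym end) , c≡)) nbr′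
      ; below = assign-below (≼-trans below τ≼τ′) o
      ; end   = set-same φ′ (q (suc j)) w
      ; keep  = λ g∈ → trans (set-∈ φ′ new (∈-upto⁺ˡ q j g∈)) (keep g∈)
      }
      where
      open Replay rp
      x = code l (c j)
      qj∈ : q j ∈ₗ upto q j Dom
      qj∈ = ∈-upto⁺ʳ q j q0∈ ≤-refl
      f′ : σ′ w ≡ free
      f′ = ≼-free below f
      nbr′ : ∀ {g i} → g ∈ₗ upto q j Dom → col g (q (suc j)) ≡ just i → Graph.Adj (𝒢 i) (φ′ g) w
      nbr′ {g} {i} g∈ cg with nbr {φ′} keep g∈ cg
      ... | inj₂ a = a
      ... | inj₁ refl with trans (sym c≡) cg
      ...   | refl = subst (λ a → Graph.Adj (𝒢 (c j)) a w) (sym end)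
                       (R-adj {l} {c j} (subst (λ a → σ₀ a ≢ dead) end (not-dead emb qj∈)) r)

    -- Assignments start again from `σ` and follow only the chain. The outcome stays below `τ`, so
    -- the rest of the tree is released.
    replay : ∀ {j τ l} → Chain τ₀ v c j τ l →
      (∀ {i} → i < j → q (suc i) ∉ₗ upto q i Dom × col (q i) (q (suc i)) ≡ just (c i) ×
        (∀ {g} → g ∈ₗ upto q i Dom → HAdj H g (q (suc i)) → g ≡ q i)) →
      Replay φ Dom q τ j l
    replay nil ok = record { σ′ = σ ; φ′ = φ ; emb = e ; below = p₀ ; end = q0↦ ; keep = λ _ → refl }
    replay (snoc ch τ≼τ′ f o r) ok with ok ≤-refl
    ... | new , c≡ , only = replay-snoc (replay ch (λ i< → ok (m≤n⇒m≤1+n i<))) τ≼τ′ f o r new c≡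
                              λ {_} {_} {i} _ g∈ cg → inj₁ (only g∈ (i , cg))

  -- Closing a path by two trees and a middle edge

  module Connect (sj : SJoined s 𝒢) {b k : ℕ} (b≤D : b ≤ D) (s≤bᵏ : s ≤ b ^ k)
    (roomy : geometric b k + (geometric b k + 0) + (m + (# (Used? σ₀) + s + D * (2 * s))) ≤ n)
    where

    h L : ℕ
    h = suc k
    L = suc (h + h)

    module _ {q : ℕ → Fin m} {Dom : List (Fin m)} (seg : IsSegment H q L Dom) where
      open IsSegment seg
      open Segment seg

      q′ : ℕ → Fin m
      q′ j = q (L ∸ j)

      h<L : h < L
      h<L = s≤s (m≤m+n h h)

      h+1<L : suc h < L
      h+1<L = s≤s (m<m+n h (s≤s z≤n))

      complement : ∀ {i} → i < L → L ∸ i ≡ suc (L ∸ suc i)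
      complement {i} (s≤s i≤) = +-∸-assoc 1 i≤

      L∸h : L ∸ h ≡ suc h
      L∸h = trans (cong (_∸ k) (sym (+-suc k h))) (m+n∸m≡n k (suc h))

      B-far : ∀ {i} → i ≤ h → suc h ≤ L ∸ i
      B-far {i} i≤ = subst (_≤ L ∸ i) L∸h (∸-monoʳ-≤ L i≤)

      DomA : List (Fin m)
      DomA = upto q h Dom

      locateB : ∀ {i j} → i ≤ L → q i ∈ₗ upto q′ j DomA → i ≤ h ⊎ L ∸ j ≤ i
      locateB {i} {j} i≤ qi∈ with ∈-upto⁻ q′ j qi∈
      ... | inj₁ p = [ inj₁ , (λ { refl → inj₂ (m∸n≤m L j) }) ]′ (locate-upto i≤ (<⇒≤ h<L) p)
      ... | inj₂ (a , a≤ , eq) =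
        inj₂ (subst (L ∸ j ≤_) (sym (q-injective i≤ (m∸n≤m L a) eq)) (∸-monoʳ-≤ L a≤))

      B-new : ∀ {i} → i < h → q′ (suc i) ∉ₗ upto q′ i DomA
      B-new {i} i<h p = [ (λ le → <-irrefl refl (≤-trans (B-far i<h) le))
        , (λ le → <-irrefl refl (≤-trans (≤-reflexive (sym (complement (<-trans i<h h<L)))) le)) ]′ (locateB {j = i} (m∸n≤m L (suc i)) p)

      -- The reversed half can touch the first half only along the middle edge from `q h` to
      -- `q (suc h)`. Since `L ∸ h` equals `suc h`, this concerns its last vertex alone, whence
      -- `B-only` below `k`.
      B-nbr : ∀ {i g} → i < h → g ∈ₗ upto q′ i DomA → HAdj H g (q′ (suc i)) → g ≡ q′ i ⊎ (g ≡ q h × L ∸ suc i ≡ suc h)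
      B-nbr {i} i<h g∈ gq with nbrs {L ∸ suc i} (≤-trans (s≤s z≤n) (B-far i<h)) (∸-monoʳ-< {L} (s≤s z≤n) (≤-trans i<h (<⇒≤ h<L))) gq
      ... | a , _  , refl , inj₁ eq = inj₁ (cong q (trans eq (sym (complement (<-trans i<h h<L)))))
      ... | a , a≤ , refl , inj₂ eq with locateB {j = i} a≤ g∈
      ...   | inj₂ le = contradiction
        (≤-trans (≤-reflexive (sym (trans (complement (<-trans i<h h<L)) (cong suc eq)))) le) λ lt → <-irrefl refl (<-trans (n<1+n a) lt)
      ...   | inj₁ a≤h = inj₂ (cong q a≡h , trans eq (cong suc a≡h))
        where
        a≡h : a ≡ h
        a≡h = ≤-antisym a≤h (≤-pred (≤-trans (B-far i<h) (≤-reflexive eq)))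

      B-only : ∀ {i g} → i < k → g ∈ₗ upto q′ i DomA → HAdj H g (q′ (suc i)) → g ≡ q′ i
      B-only {i} i<k g∈ gq with B-nbr (m≤n⇒m≤1+n i<k) g∈ gq
      ... | inj₁ eq = eq
      ... | inj₂ (_ , eq) = contradiction (≤-trans (s≤s (B-far (s≤s i<k)))
        (≤-reflexive (trans (sym (complement (≤-<-trans i<k (<-trans (n<1+n k) h<L)))) eq))) (<-irrefl refl)

      i₀ : Fin t
      i₀ = proj₁ (link {0} (s≤s z≤n))

      -- `Chain` takes a total sequence of colours. The default `i₀` is not reached for `j < L`,
      -- where `A-col` and `B-col` identify the true colours.
      A-colour B-colour : ℕ → Fin t
      A-colour j = fromMaybe i₀ (col (q j) (q (suc j)))
      B-colour j = fromMaybe i₀ (col (q′ j) (q′ (suc j)))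

      A-col : ∀ {j} → j < L → col (q j) (q (suc j)) ≡ just (A-colour j)
      A-col {j} j<L with col (q j) (q (suc j)) | link j<L
      ... | just _  | _ = refl
      ... | nothing | ()

      B-col : ∀ {j} → j < L → col (q′ j) (q′ (suc j)) ≡ just (B-colour j)
      B-col {j} j<L with col (q′ j) (q′ (suc j)) | link′
        where
        link′ : HAdj H (q′ j) (q′ (suc j))
        link′ with link {L ∸ suc j} (∸-monoʳ-< {L} (s≤s z≤n) j<L)
        ... | i , c = i , trans (ColGraph.sym H _ _) (trans (cong (λ a → col (q′ (suc j)) (q a)) (complement j<L)) c)
      ... | just _  | _ = refl
      ... | nothing | ()

      open Tree hiding (roomy)

      -- The leaves of the first tree are tagged with the colour `i` of the middle edge. The edge
      -- comes from `sj` directly and is not recorded as an ownership.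
      middle : ∀ {σ v c v′ c′ r r′} (i : Fin t) (treeA : Tree b σ v c k r) (treeB : Tree b (τ treeA) v′ c′ k r′) →
        ∃₂ λ x y → x ∈ₗ leaves treeA × y ∈ₗ leaves treeB × Graph.Adj (𝒢 i) x y
      middle i treeA treeB with sj (map (_, i) (leaves treeA)) (leaves treeB)
          (Uniqueₚ.map⁺ (cong proj₁) (unique treeA)) (unique treeB)
          (≤-trans s≤bᵏ (≤-reflexive (sym (trans (length-map (_, i) (leaves treeA)) (count treeA)))))
          (≤-trans s≤bᵏ (≤-reflexive (sym (count treeB))))
      ... | x , _ , y , xi∈ , y∈ , xy with ∈-map⁻ (_, i) xi∈
      ...   | _ , x∈ , refl = x , y , x∈ , y∈ , xy

      replayA : ∀ {σ φ τ x} → Emb σ φ Dom → Chain σ (φ (q 0)) A-colour h τ x → Replay φ Dom q τ h x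
      replayA e chain = replay q e ≼-refl start∈ refl chain λ i<h →
        advance-new (≤-<-trans i<h h<L) , A-col (<-trans i<h h<L) , advance-only (≤-<-trans (s≤s i<h) h+1<L)

      replayB : ∀ {σ φ τ₀ v τ x y} → Emb σ φ DomA → σ ≼ τ₀ → φ (q L) ≡ v → φ (q h) ≡ x →
        Graph.Adj (𝒢 (A-colour h)) x y → Chain τ₀ v B-colour h τ y → Replay φ DomA q′ τ h y
      replayB {φ = φ} {τ₀ = τ₀} {y = y} e below qL↦ qh↦ xy (snoc chain τ≼ f o r) =
        -- The last vertex is attached separately: its neighbours already embedded are its
        -- predecessor and `q h`, and `xy` supplies the edge to the latter.
        replay-snoc {τ₀ = τ₀} {c = B-colour} q′ e below qL∈A qL↦
        (replay q′ e below qL∈A qL↦ chain λ i<k →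
          B-new (m≤n⇒m≤1+n i<k) , B-col (<-trans i<k (<-trans k<h h<L)) , B-only i<k)
        τ≼ f o r (B-new k<h) (B-col (<-trans k<h h<L)) (λ {φ′} {g} {i} → last-nbr {φ′} {g} {i})
        where
        k<h : k < h
        k<h = n<1+n k
        qL∈A : q L ∈ₗ DomA
        qL∈A = ∈-upto⁺ˡ q h finish∈
        last-nbr : ∀ {φ′ g i} → (∀ {a} → a ∈ₗ DomA → φ′ a ≡ φ a) → g ∈ₗ upto q′ k DomA →
          col g (q′ h) ≡ just i → g ≡ q′ k ⊎ Graph.Adj (𝒢 i) (φ′ g) y
        last-nbr {φ′} {i = i} keep g∈ c with B-nbr k<h g∈ (_ , c)
        ... | inj₁ eq = inj₁ eq
        ... | inj₂ (refl , eq) = inj₂ (subst₂ (λ j a → Graph.Adj (𝒢 j) a y)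
          (just-injective (trans (sym (A-col h<L)) (trans (cong (λ a → col (q h) (q a)) (sym eq)) c)))
          (sym (trans (keep (here refl)) qh↦)) xy)

      join : ∀ {σ φ r r′} → Emb σ φ Dom → (treeA : Tree b σ (φ (q 0)) A-colour k r) →
        Tree b (τ treeA) (φ (q L)) B-colour k r′ → Conf (upto q′ h DomA)
      join e treeA treeB with middle (A-colour h) treeA treeB
      ... | x , y , x∈ , y∈ , xy with replayA e (Leaf.chain (leaf treeA x∈))
      ...   | A with replayB (Replay.emb A) (Replay.below A) (Replay.keep A finish∈) (Replay.end A) xy (Leaf.chain (leaf treeB y∈))
      ...     | B = Replay.σ′ B , Replay.φ′ B , Replay.emb B ,
        -- The replayed state lies below the state holding both full trees, so dropping all their
        -- other vertices keeps it extendable.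
        extendable-≼ (Replay.below B) (Good.valid (state treeB)) (Good.extendable (state treeB))

      -- The first tree gives children only to the image of `q 0` and to vertices that were free.
      -- The image of `q L` is neither, so the bound from before that tree persists.
      few : ∀ {σ φ r} → Emb σ φ Dom → (treeA : Tree b σ (φ (q 0)) A-colour k r) →
        children (τ treeA) (code (φ (q L)) (B-colour 0)) < D
      few {σ} {φ} e treeA = ≤-<-trans (children-mono {σ} {τ treeA} (new treeA) unrelated)
        (children<D e finish∈ (interior∉ (s≤s z≤n) ≤-refl) (B-col (s≤s z≤n)))
        where
        unrelated : ¬ (code (φ (q L)) (B-colour 0) ≡ code (φ (q 0)) (A-colour 0)
                      ⊎ ∃₂ λ u i → code (φ (q L)) (B-colour 0) ≡ code u i × σ u ≡ free)
        unrelated (inj₁ eq) with q-injective ≤-refl z≤n (Emb.injective e finish∈ start∈ (code-injective eq))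
        ... | ()
        unrelated (inj₂ (u , _ , eq , f)) = placed-used e finish∈ (trans (cong σ (code-injective eq)) f)

      connect : Conf Dom → Conf (upto q′ h DomA)
      connect (σ , φ , e , ext) = join e treeA
        (grow b≤D k (state treeA) (≼-Used (below treeA) (placed-used e finish∈)) (few e treeA) (Tree.roomy treeA))
        where
        treeA : Tree b σ (φ (q 0)) A-colour k (geometric b k + 0)
        treeA = grow b≤D k (emb-good e ext) (placed-used e start∈)
          (children<D e start∈ (interior∉ (s≤s z≤n) (s≤s (s≤s z≤n))) (A-col (s≤s z≤n)))
          (≤-trans (+-monoʳ-≤ (geometric b k + (geometric b k + 0)) (used-bound e)) roomy)

  conf⇒contains : (∃ λ Dom → Conf Dom × ∀ h → h ∈ₗ Dom) → Contains 𝒢 H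
  conf⇒contains (Dom , (σ , φ , e , _) , all) = φ , Emb.injective e (all _) (all _) , λ x y i → Emb.adj e (all x) (all y)

  embed : SJoined s 𝒢 → ∀ {b k} → b ≤ D → s ≤ b ^ k →
    (∀ y z → y <ᶠ z → 2 * k + 3 ≤ length (ExpansionOfK.P E y z) ∸ 1) →
    geometric b k + (geometric b k + 0) + (m + (# (Used? σ₀) + s + D * (2 * s))) ≤ n →
    (Fin m → Fin n) → Extendable σ₀ → Contains 𝒢 H
  embed sj {b} {k} b≤D s≤bᵏ long budget φ₀ ext = conf⇒contains
    (Assembly.Construction.assemble {k = k} E long Conf (add-root roomy)
      (λ conf h∈ h∉ (_ , c) only → add-child roomy conf h∈ h∉ c only)
      (λ seg → Connect.connect sj b≤D s≤bᵏ budget seg) (conf-[] φ₀ ext))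
    where
    roomy : m + (# (Used? σ₀) + s + D * (2 * s)) ≤ n
    roomy = ≤-trans (m≤n+m _ (geometric b k + (geometric b k + 0))) budget

-- Numerical bounds and conclusion

geometric≤ : ∀ {b} → 2 ≤ b → ∀ k → geometric b k ≤ 2 * b ^ k
geometric≤ 2≤b zero = s≤s z≤n
geometric≤ {b} 2≤b (suc k) = begin
  geometric b k + b ^ suc k   ≤⟨ +-monoˡ-≤ (b ^ suc k) (geometric≤ 2≤b k) ⟩
  2 * b ^ k + b ^ suc k       ≤⟨ +-monoˡ-≤ (b ^ suc k) (*-monoˡ-≤ (b ^ k) 2≤b) ⟩
  b ^ suc k + b ^ suc k       ≡⟨ cong (b ^ suc k +_) (+-identityʳ (b ^ suc k)) ⟨
  2 * b ^ suc k               ∎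
  where open ≤-Reasoning

-- By minimality of the exponent, `b ^ (k ∸ 1)` is less than `s` when `k` is positive.
ceil-log-bound : ∀ {b s} → 1 ≤ s → 2 ≤ b → ∀ k → IsCeilLog b s k → b ^ k ≤ b * s
ceil-log-bound 1≤s 2≤b zero    _           = *-mono-≤ (≤-trans (s≤s z≤n) 2≤b) 1≤s
ceil-log-bound {b} {s} 1≤s 2≤b (suc k) (_ , least) = *-monoʳ-≤ b (<⇒≤ (≰⇒> λ s≤ → <-irrefl refl (least k s≤)))

module Proof (s t b k n m : ℕ) (1≤s : 1 ≤ s) (2≤b : 2 ≤ b) (log : IsCeilLog b s k)
  (𝒢 : Fin t → Graph n) (sj : SJoined s 𝒢) (H : ColGraph m t) (E : ExpansionOfK H (suc b))
  (long : ∀ y z → y <ᶠ z → 2 * k + 3 ≤ length (ExpansionOfK.P E y z) ∸ 1)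
  (mon : MonDegAtMost H (suc b)) (room : m + 6 * s * suc b ≤ n) where

  open ≤-Reasoning

  D : ℕ
  D = suc b

  junk : Fin n
  junk = fromℕ< (begin
    1               ≤⟨ *-mono-≤ 1≤s (s≤s (z≤n {b})) ⟩
    s * D           ≤⟨ *-monoˡ-≤ D (m≤m+n s (5 * s)) ⟩
    6 * s * D       ≤⟨ m≤n+m _ m ⟩
    m + 6 * s * D   ≤⟨ room ⟩
    n               ∎)

  regroup₀ : ∀ s b → 3 * s + suc b * (2 * s) + (s + 4 * (b * s)) ≡ 6 * s * suc b
  regroup₀ = solve-∀

  -- The account of `6 * s * D`: `2 * (b * s)` for each of the two trees, `s` for dead vertices, `s`
  -- for vertices missed by joinedness, `D * (2 * s)` for the reserve of `extend`, and `2 * s` left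
  -- over.
  regroup : ∀ m s b → 2 * (b * s) + (2 * (b * s) + 0) + (m + (s + s + suc b * (2 * s))) + 2 * s ≡ m + 6 * s * suc b
  regroup = solve-∀

  room₀ : 3 * s + D * (2 * s) ≤ n
  room₀ = begin
    3 * s + suc b * (2 * s)                           ≤⟨ m≤m+n _ (s + 4 * (b * s)) ⟩
    3 * s + suc b * (2 * s) + (s + 4 * (b * s))       ≡⟨ regroup₀ s b ⟩
    6 * s * suc b                                     ≤⟨ m≤n+m _ m ⟩
    m + 6 * s * suc b                                 ≤⟨ room ⟩
    n                                                 ∎

  open ChosenEdges s 𝒢 sj 1≤s
  open Initial R₀ R₀? s D (base junk) 1≤s (joined₀ D) room₀
  open Expander R R? s D using (Used?)

  code-injectiveˡ : ∀ {u v i j} → code u i ≡ code v j → u ≡ v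
  code-injectiveˡ {u} {v} {i} {j} eq = combine-injectiveˡ u i v j (suc-injectiveᶠ eq)

  code-injectiveʳ : ∀ {u v i j} → code u i ≡ code v j → i ≡ j
  code-injectiveʳ {u} {v} {i} {j} eq = combine-injectiveʳ u i v j (suc-injectiveᶠ eq)

  R-adj : ∀ {v i w} → σ₀ v ≢ dead → R (code v i) w → Graph.Adj (𝒢 i) v w
  R-adj {v} {i} alive (inj₁ r)  = R₀-adj {v} {i} r
  -- A fake edge starts at a member of the bad set, whose projection `v` is dead.
  R-adj {v} {i} alive (inj₂ x∈) = contradiction (subst (λ u → σ₀ u ≡ dead) (base-code junk v i) (σ₀-dead x∈)) alive

  budget : geometric b k + (geometric b k + 0) + (m + (# (Used? σ₀) + s + D * (2 * s))) ≤ n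
  budget = begin
    geometric b k + (geometric b k + 0) + (m + (# (Used? σ₀) + s + D * (2 * s)))
      ≤⟨ +-mono-≤ (+-mono-≤ tree (+-monoˡ-≤ 0 tree)) (+-monoʳ-≤ m (+-monoˡ-≤ (D * (2 * s)) (+-monoˡ-≤ s #-σ₀-used))) ⟩
    2 * (b * s) + (2 * (b * s) + 0) + (m + (s + s + suc b * (2 * s)))
      ≤⟨ m≤m+n _ (2 * s) ⟩
    2 * (b * s) + (2 * (b * s) + 0) + (m + (s + s + suc b * (2 * s))) + 2 * s
      ≡⟨ regroup m s b ⟩
    m + 6 * s * suc b
      ≤⟨ room ⟩
    n ∎
    where
    tree : geometric b k ≤ 2 * (b * s)
    tree = ≤-trans (geometric≤ 2≤b k) (*-monoʳ-≤ 2 (ceil-log-bound 1≤s 2≤b k log))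

  contains : Contains 𝒢 H
  contains = Embedding.embed R R? s D code code-injectiveˡ code-injectiveʳ 1≤s joined zero (λ ())
    𝒢 H mon E σ₀ σ₀-unowned R-adj sj {b} {k} (n≤1+n b) (proj₁ log) long budget (λ _ → junk) σ₀-extendable

theorem1p5 : (s t D : ℕ) → 1 ≤ s → 1 ≤ t → 3 ≤ D →
    (k : ℕ) → IsCeilLog (D ∸ 1) s k →
    (n : ℕ) (𝒢 : Fin t → Graph n) → SJoined s 𝒢 →
    (m : ℕ) (H : ColGraph m t) (E : ExpansionOfK H D) →
    (∀ y z → y <ᶠ z → 2 * k + 3 ≤ length (ExpansionOfK.P E y z) ∸ 1) →
    MonDegAtMost H D →
    m + 6 * s * D ≤ n →
    Contains 𝒢 H
theorem1p5 s t (suc b) 1≤s 1≤t (s≤s 2≤b) k log n 𝒢 sj m H E long mon room =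
  Proof.contains s t b k n m 1≤s 2≤b log 𝒢 sj H E long mon room
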